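{- For every integer $n\geq1$, the $(3,1)$-polygraph $\Sigma^{\mathrm{row,coh}}(n)$, obtained from the row presentation $\Sigma^{\mathrm{row}}(n)$ by adjoining for each triple of rows $(u,v,t)\in\mathcal R_n^3$ with $u\not\triangleleft v$ and $v\not\triangleleft t$ one generating $3$-cell $$\mathcal X_{u,v,t}\colon(\alpha_{u,v}1_{r_t})\star_1\Lambda_{\mathcal R(N(uv))r_t}\Rrightarrow(1_{r_u}\alpha_{v,t})\star_1\Lambda_{r_u\mathcal R(N(vt))},$$ is a finite coherent presentation of the stylic monoid $\mathrm{Styl}_n$.
   Context: **Rows and $N$-tableaux.** Fix $n\geq1$, $[n]=\{1<2<\cdots<n\}$. For a word $w$ over $[n]$, $\mathrm{supp}(w)$ is its set of letters. A row is a nonempty strictly increasing word over $[n]$, identified with its support; $\mathcal R_n$ is the set of rows. For rows $u,v$, $u\triangleleft v$ means $\mathrm{supp}(u)\subseteq\mathrm{supp}(v)$ and $\min(v)<\min(u)$. An $N$-tableau $T$ is a finite sequence of rows $u_k,\dots,u_1$ (top to bottom) with $u_{i+1}\triangleleft u_i$ for all $i$; $\mathcal R(T):=r_{u_k}\cdots r_{u_1}$ is its row-generator reading. Right $N$-insertion of a letter $x$: insert $x$ in the bottom row $u_1$, i.e. replace $u_1$ by the row with support $\mathrm{supp}(u_1)\cup\{x\}$; if $u_1$ has a letter $>x$, the smallest such letter $y$ is bumped (it also stays in the row) and is inserted in the same way into the next row above, and so on; a letter bumped from the top row creates a new top row consisting of that letter. For a word $w$, $N(w)$ is obtained by inserting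 its letters from left to right starting from the empty tableau (inserting $x$ in the empty tableau gives the one-row tableau $x$). For rows $u,v$, $N(uv)$ has at most two rows. **Polygraphs.** A $2$-polygraph $\Sigma=(\Sigma_1,\Sigma_2)$ is a set $\Sigma_1$ together with a set $\Sigma_2$ of $2$-cells $\beta\colon u\Rightarrow v$ between words of $\Sigma_1^*$; it presents the quotient of $\Sigma_1^*$ by the congruence generated by $\Sigma_2$. $\Sigma_2^\top$ is the free $(2,1)$-category (track $2$-category) on $\Sigma$; $0$-composition is juxtaposition, $1$-composition is $\star_1$. A $(3,1)$-polygraph $(\Sigma,\Sigma_3)$ is a $2$-polygraph with a set $\Sigma_3$ of generating $3$-cells $A\colon f\Rrightarrow g$ between parallel $2$-cells $f,g$ of $\Sigma_2^\top$. It is a coherent presentation of a monoid $M$ if $\Sigma$ presents $M$ and $\Sigma_3$ is a homotopy basis, i.e. every pair of parallel $2$-cells $(f,g)$ of $\Sigma_2^\top$ is filled by a $3$-cell $f\Rrightarrow g$ of the free $(3,1)$-category generated by $(\Sigma,\Sigma_3)$. It is finite if all generating sets are finite. **Stylic monoid.** $\mathrm{Styl}_n$ is the monoid generated by $[n]$ subject to $xx=x$ ($x\in[n]$), $zxy=xzy$ ($x\leq y<z$), $yzx=yxz$ ($x<y\leq z$). **Row presentation.** $\Sigma^{\mathrm{row}}(n)$ has generating $1$-cells $r_u$, $u\in\mathcal R_n$, and generating $2$-cells $\alpha_{u,v}\colon r_ur_v\Rightarrow\mathcal R(N(uv))$ for all rows $u,v$ with $u\not\triangleleft v$. It is known to be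 convergent (terminating and confluent) and to present $\mathrm{Styl}_n$; its irreducible words are the $\mathcal R(T)$ for $T$ an $N$-tableau. For a word $w$ in the $r_u$, $\Lambda_w\colon w\Rightarrow\widehat w$ denotes the leftmost normalization path from $w$ to its unique normal form $\widehat w$ (always rewrite the leftmost reducible adjacent pair). -}

module Defs where

open import Algebra.Bundles using (Monoid)
open import Algebra.Morphism.Structures using (module MonoidMorphisms)
open import Data.Empty using (⊥-elim; ⊥-elim-irr)
open import Data.Fin.Base using (Fin; zero; suc; _<_; _≤_)
open import Data.Fin.Properties using (_<?_)
open import Data.Fin.Subset using (Subset; inside; outside; _⊆_; _∪_; ⁅_⁆; Nonempty)
open import Data.Fin.Subset.Properties using (_∈?_; _⊆?_; x∈⁅x⁆; q⊆p∪q)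
open import Data.List.Base
  using (List; []; _∷_; [_]; _++_; allFin; filter; foldl; head; reverse)
open import Data.List.Properties using (++-assoc; ++-identityˡ; ++-identityʳ)
open import Data.List.Relation.Unary.Linked as Linked using (Linked; []; [-]; _∷_)
open import Data.Maybe.Base using (Maybe; maybe′)
open import Data.Nat.Base using (ℕ)
open import Data.Product.Base using (∃; _×_; _,_; proj₁; proj₂)
open import Data.Vec.Base using ([]; _∷_; here; there)
open import Function.Base using (flip)
open import Function.Bundles using (_↔_)
open import Induction.WellFounded using (Acc; acc)
open import Level using (0ℓ; _⊔_)
open import Relation.Binary.Construct.Closure.ReflexiveTransitive using (Star; ε; _◅_)
open import Relation.Binary.Core using (Rel)
open import Relation.Binary.PropositionalEquality as ≡ using (_≡_; subst; subst₂)
open import Relation.Binary.Rewriting using (IsNormalForm; StronglyNormalizing; Confluent)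
open import Relation.Nullary using (¬_; Dec; yes; no; _×-dec_)

private
  variable
    n : ℕ

module _ {A : Set} (R : Rel (List A) 0ℓ) where

  data Congruence : Rel (List A) 0ℓ where
    gen   : ∀ {u v} → R u v → Congruence u v
    refl  : ∀ {u} → Congruence u u
    sym   : ∀ {u v} → Congruence u v → Congruence v u
    trans : ∀ {u v w} → Congruence u v → Congruence v w → Congruence u w
    cong  : ∀ {u u′ v v′} → Congruence u u′ → Congruence v v′ →
            Congruence (u ++ v) (u′ ++ v′)

  quotientMonoid : Monoid 0ℓ 0ℓ
  quotientMonoid = record
    { Carrier  = List A
    ; _≈_      = Congruence
    ; _∙_      = _++_
    ; ε        = []
    ; isMonoid = record
      { isSemigroup = record
        { isMagma = record
          { isEquivalence = record { refl = refl ; sym = sym ; trans = trans }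
          ; ∙-cong        = cong
          }
        ; assoc = λ u v w → reflexive (++-assoc u v w)
        }
      ; identity = (λ u → refl) , (λ u → reflexive (++-identityʳ u))
      }
    }
    where
    reflexive : ∀ {u v} → u ≡ v → Congruence u v
    reflexive ≡.refl = refl

-- All polygraphs here have a single 0-cell, so 1-cells of the free category
-- are words.
record 2-Polygraph : Set₁ where
  field
    Σ₁    : Set
    Σ₂    : Set
    s₁ t₁ : Σ₂ → List Σ₁

  Word : Set
  Word = List Σ₁

  data Relator : Rel Word 0ℓ where
    relator : ∀ β → Relator (s₁ β) (t₁ β)

  presentedMonoid : Monoid 0ℓ 0ℓ
  presentedMonoid = quotientMonoid Relator

  infix 4 _⟶_

  data _⟶_ : Rel Word 0ℓ where
    whisker : ∀ l β r → l ++ (s₁ β ++ r) ⟶ l ++ (t₁ β ++ r)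

  record Convergent : Set where
    field
      terminating : StronglyNormalizing _⟶_
      confluent   : Confluent _⟶_

  -- The 2-cells of the free (2,1)-category are the terms of _⇒_ modulo _≈_.

  infix  4 _⇒_ _≈_
  infixl 6 _⋆₁_
  infixr 7 _⋆₀_
  infix  8 _⁻¹

  data _⇒_ : Word → Word → Set where
    gen  : ∀ β → s₁ β ⇒ t₁ β
    id   : ∀ u → u ⇒ u
    _⋆₁_ : ∀ {u v w} → u ⇒ v → v ⇒ w → u ⇒ w
    _⋆₀_ : ∀ {u u′ v v′} → u ⇒ u′ → v ⇒ v′ → u ++ v ⇒ u′ ++ v′
    _⁻¹  : ∀ {u v} → u ⇒ v → v ⇒ u

  -- 1-cells compose strictly, but _++_ is associative and unital only up to
  -- propositional equality, so three of the laws below relate 2-cells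
  -- transported along an equality of words.
  data _≈_ : ∀ {u v} → u ⇒ v → u ⇒ v → Set where
    refl  : ∀ {u v} {f : u ⇒ v} → f ≈ f
    sym   : ∀ {u v} {f g : u ⇒ v} → f ≈ g → g ≈ f
    trans : ∀ {u v} {f g h : u ⇒ v} → f ≈ g → g ≈ h → f ≈ h

    ⋆₁-cong : ∀ {u v w} {f f′ : u ⇒ v} {g g′ : v ⇒ w} →
              f ≈ f′ → g ≈ g′ → f ⋆₁ g ≈ f′ ⋆₁ g′
    ⋆₀-cong : ∀ {u u′ v v′} {f f′ : u ⇒ u′} {g g′ : v ⇒ v′} →
              f ≈ f′ → g ≈ g′ → f ⋆₀ g ≈ f′ ⋆₀ g′
    ⁻¹-cong : ∀ {u v} {f f′ : u ⇒ v} → f ≈ f′ → f ⁻¹ ≈ f′ ⁻¹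

    ⋆₁-assoc     : ∀ {u v w x} (f : u ⇒ v) (g : v ⇒ w) (h : w ⇒ x) →
                   (f ⋆₁ g) ⋆₁ h ≈ f ⋆₁ (g ⋆₁ h)
    ⋆₁-identityˡ : ∀ {u v} (f : u ⇒ v) → id u ⋆₁ f ≈ f
    ⋆₁-identityʳ : ∀ {u v} (f : u ⇒ v) → f ⋆₁ id v ≈ f
    ⋆₁-inverseˡ  : ∀ {u v} (f : u ⇒ v) → f ⁻¹ ⋆₁ f ≈ id v
    ⋆₁-inverseʳ  : ∀ {u v} (f : u ⇒ v) → f ⋆₁ f ⁻¹ ≈ id u

    ⋆₀-id       : ∀ u v → id u ⋆₀ id v ≈ id (u ++ v)
    interchange : ∀ {u v w u′ v′ w′}
                  (f : u ⇒ v) (g : v ⇒ w) (f′ : u′ ⇒ v′) (g′ : v′ ⇒ w′) →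
                  (f ⋆₁ g) ⋆₀ (f′ ⋆₁ g′) ≈ (f ⋆₀ f′) ⋆₁ (g ⋆₀ g′)

    ⋆₀-assoc     : ∀ {u u′ v v′ w w′} (f : u ⇒ u′) (g : v ⇒ v′) (h : w ⇒ w′) →
                   subst₂ _⇒_ (++-assoc u v w) (++-assoc u′ v′ w′) ((f ⋆₀ g) ⋆₀ h)
                   ≈ f ⋆₀ (g ⋆₀ h)
    ⋆₀-identityˡ : ∀ {u v} (f : u ⇒ v) →
                   subst₂ _⇒_ (++-identityˡ u) (++-identityˡ v) (id [] ⋆₀ f) ≈ f
    ⋆₀-identityʳ : ∀ {u v} (f : u ⇒ v) →
                   subst₂ _⇒_ (++-identityʳ u) (++-identityʳ v) (f ⋆₀ id []) ≈ f

record [3,1]-Polygraph : Set₁ where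
  field
    Σ : 2-Polygraph

  open 2-Polygraph Σ public

  field
    Σ₃      : Set
    ∂⁻ ∂⁺   : Σ₃ → Word
    s₂ t₂   : (A : Σ₃) → ∂⁻ A ⇒ ∂⁺ A

  infix 4 _⇛_

  -- Terms for the 3-cells of the free (3,1)-category.  They are not quotiented
  -- by the axioms of a (3,1)-category, as only their existence is ever used.
  -- The constructor `identity` makes _⇛_ well defined on 2-cells modulo _≈_.
  data _⇛_ : ∀ {u v} → u ⇒ v → u ⇒ v → Set where
    gen      : ∀ A → s₂ A ⇛ t₂ A
    identity : ∀ {u v} {f g : u ⇒ v} → f ≈ g → f ⇛ g
    _⋆₂_     : ∀ {u v} {f g h : u ⇒ v} → f ⇛ g → g ⇛ h → f ⇛ h
    _⋆₁_     : ∀ {u v w} {f f′ : u ⇒ v} {g g′ : v ⇒ w} →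
               f ⇛ f′ → g ⇛ g′ → f ⋆₁ g ⇛ f′ ⋆₁ g′
    _⋆₀_     : ∀ {u u′ v v′} {f f′ : u ⇒ u′} {g g′ : v ⇒ v′} →
               f ⇛ f′ → g ⇛ g′ → f ⋆₀ g ⇛ f′ ⋆₀ g′
    _⁻¹      : ∀ {u v} {f g : u ⇒ v} → f ⇛ g → g ⇛ f

  IsHomotopyBasis : Set
  IsHomotopyBasis = ∀ {u v} (f g : u ⇒ v) → f ⇛ g

Presents : ∀ {c ℓ} → 2-Polygraph → Monoid c ℓ → Set (c ⊔ ℓ)
Presents Σ M = ∃ λ φ → IsMonoidIsomorphism φ
  where open MonoidMorphisms (Monoid.rawMonoid (2-Polygraph.presentedMonoid Σ))
                             (Monoid.rawMonoid M)

record IsCoherentPresentation {c ℓ} (P : [3,1]-Polygraph) (M : Monoid c ℓ) :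
       Set (c ⊔ ℓ) where
  open [3,1]-Polygraph P
  field
    presents        : Presents Σ M
    isHomotopyBasis : IsHomotopyBasis

Finite : Set → Set
Finite A = ∃ λ k → A ↔ Fin k

record IsFinite (P : [3,1]-Polygraph) : Set where
  open [3,1]-Polygraph P
  field
    finite₁ : Finite Σ₁
    finite₂ : Finite Σ₂
    finite₃ : Finite Σ₃

record IsFiniteCoherentPresentation {c ℓ} (P : [3,1]-Polygraph) (M : Monoid c ℓ) :
       Set (c ⊔ ℓ) where
  field
    isFinite               : IsFinite P
    isCoherentPresentation : IsCoherentPresentation P M

data StylicRelation {n} : Rel (List (Fin n)) 0ℓ where
  xx≈x    : ∀ x → StylicRelation (x ∷ x ∷ []) (x ∷ [])
  zxy≈xzy : ∀ {x y z} → x ≤ y → y < z →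
            StylicRelation (z ∷ x ∷ y ∷ []) (x ∷ z ∷ y ∷ [])
  yzx≈yxz : ∀ {x y z} → x < y → y ≤ z →
            StylicRelation (y ∷ z ∷ x ∷ []) (y ∷ x ∷ z ∷ [])

Styl : ℕ → Monoid 0ℓ 0ℓ
Styl n = quotientMonoid (StylicRelation {n})

-- Nonemptiness is irrelevant, so that rows with the same support are equal.
record Row (n : ℕ) : Set where
  constructor row
  field
    supp      : Subset n
    .nonempty : Nonempty supp

open Row using (supp)

minimum : (p : Subset n) → .(Nonempty p) → Fin n
minimum []            ne = ⊥-elim-irr (empty ne)
  where
  empty : ¬ Nonempty []
  empty (() , _)
minimum (inside  ∷ p) ne = zero
minimum (outside ∷ p) ne = suc (minimum p (tail ne))
  where
  tail : Nonempty (outside ∷ p) → Nonempty p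
  tail (suc x , there x∈p) = x , x∈p

min : Row n → Fin n
min (row p ne) = minimum p ne

infix 4 _◁_ _⋪_ _◁?_

_◁_ _⋪_ : Rel (Row n) 0ℓ
u ◁ v = supp u ⊆ supp v × min v < min u
u ⋪ v = ¬ u ◁ v

_◁?_ : (u v : Row n) → Dec (u ◁ v)
u ◁? v = (supp u ⊆? supp v) ×-dec (min v <? min u)

-- Listed in increasing order, so that `head` in `bumped` picks the smallest.
letters : Row n → List (Fin n)
letters u = filter (_∈? supp u) (allFin _)

singleton : Fin n → Row n
singleton x = row ⁅ x ⁆ (x , x∈⁅x⁆ x)

add : Fin n → Row n → Row n
add x u = row (supp u ∪ ⁅ x ⁆) (x , q⊆p∪q (supp u) ⁅ x ⁆ (x∈⁅x⁆ x))

bumped : Fin n → Row n → Maybe (Fin n)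
bumped x u = head (filter (x <?_) (letters u))

-- Rows are listed from bottom to top.
Tableau : ℕ → Set
Tableau n = List (Row n)

insert : Fin n → Tableau n → Tableau n
insert x []      = singleton x ∷ []
insert x (u ∷ T) = add x u ∷ maybe′ (λ y → insert y T) T (bumped x u)

N : List (Fin n) → Tableau n
N = foldl (flip insert) []

𝓡 : Tableau n → List (Row n)
𝓡 = reverse

𝓡N : Row n → Row n → List (Row n)
𝓡N u v = 𝓡 (N (letters u ++ letters v))

record ReduciblePair (n : ℕ) : Set where
  constructor α
  field
    u v  : Row n
    .u⋪v : u ⋪ v

Σrow : ℕ → 2-Polygraph
Σrow n = record
  { Σ₁ = Row n
  ; Σ₂ = ReduciblePair n
  ; s₁ = λ (α u v _) → u ∷ v ∷ []
  ; t₁ = λ (α u v _) → 𝓡N u v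
  }

module _ {n : ℕ} where

  open 2-Polygraph (Σrow n)

  -- A pair is contracted only when all the pairs to its left are irreducible.
  data LeftmostStep : Word → Word → Set where
    here  : ∀ u v w → .(u⋪v : u ⋪ v) → LeftmostStep (u ∷ v ∷ w) (𝓡N u v ++ w)
    there : ∀ {u v w w′} → u ◁ v → LeftmostStep (v ∷ w) w′ →
            LeftmostStep (u ∷ v ∷ w) (u ∷ w′)

  data LeftmostPath : Word → Word → Set where
    done : ∀ {w} → Linked _◁_ w → LeftmostPath w w
    _∷_  : ∀ {w w′ ŵ} → LeftmostStep w w′ → LeftmostPath w′ ŵ → LeftmostPath w ŵ

  stepCell : ∀ {w w′} → LeftmostStep w w′ → w ⇒ w′
  stepCell (here u v w u⋪v) = gen (α u v u⋪v) ⋆₀ id w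
  stepCell (there {u} _ s)  = id [ u ] ⋆₀ stepCell s

  pathCell : ∀ {w ŵ} → LeftmostPath w ŵ → w ⇒ ŵ
  pathCell (done {w} _) = id w
  pathCell (s ∷ p)      = stepCell s ⋆₁ pathCell p

  step⇒⟶ : ∀ {w w′} → LeftmostStep w w′ → w ⟶ w′
  step⇒⟶ (here u v w u⋪v) = whisker [] (α u v u⋪v) w
  step⇒⟶ (there {u} _ s)  = cons (step⇒⟶ s)
    where
    cons : ∀ {w w′} → w ⟶ w′ → u ∷ w ⟶ u ∷ w′
    cons (whisker l β r) = whisker (u ∷ l) β r

  path⇒↠ : ∀ {w ŵ} → LeftmostPath w ŵ → Star _⟶_ w ŵ
  path⇒↠ (done _) = ε
  path⇒↠ (s ∷ p)  = step⇒⟶ s ◅ path⇒↠ p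

  linked⇒normal : ∀ {w} → Linked _◁_ w → IsNormalForm _⟶_ w
  linked⇒normal lnk (_ , whisker l (α u v u⋪v) r) = ⊥-elim-irr (u⋪v (pair l lnk))
    where
    pair : ∀ l → Linked _◁_ (l ++ u ∷ v ∷ r) → u ◁ v
    pair []      (u◁v ∷ _) = u◁v
    pair (x ∷ l) lnk       = pair l (Linked.tail lnk)

  path⇒normal : ∀ {w ŵ} → LeftmostPath w ŵ → IsNormalForm _⟶_ ŵ
  path⇒normal (done lnk) = linked⇒normal lnk
  path⇒normal (_ ∷ p)    = path⇒normal p

  data Progress (w : Word) : Set where
    irreducible : Linked _◁_ w → Progress w
    reducible   : ∀ {w′} → LeftmostStep w w′ → Progress w

  progress : ∀ w → Progress w
  progress []          = irreducible []
  progress (u ∷ [])    = irreducible [-]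
  progress (u ∷ v ∷ w) with u ◁? v | progress (v ∷ w)
  ... | no u⋪v  | _               = reducible (here u v w u⋪v)
  ... | yes u◁v | irreducible lnk = irreducible (u◁v ∷ lnk)
  ... | yes u◁v | reducible s     = reducible (there u◁v s)

  leftmostPath : ∀ w → Acc (flip _⟶_) w → ∃ (LeftmostPath w)
  leftmostPath w (acc rec) with progress w
  ... | irreducible lnk = w , done lnk
  ... | reducible s     with leftmostPath _ (rec (step⇒⟶ s))
  ...   | ŵ , p         = ŵ , s ∷ p

  module Normalisation (convergent : Convergent) where

    open Convergent convergent

    path : ∀ w → ∃ (LeftmostPath w)
    path w = leftmostPath w (terminating w)

    nf : Word → Word
    nf w = proj₁ (path w)

    Λ : ∀ w → w ⇒ nf w
    Λ w = pathCell (proj₂ (path w))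

    unique : ∀ {w ŵ₁ ŵ₂} → Star _⟶_ w ŵ₁ → IsNormalForm _⟶_ ŵ₁ →
             Star _⟶_ w ŵ₂ → IsNormalForm _⟶_ ŵ₂ → ŵ₁ ≡ ŵ₂
    unique r₁ n₁ r₂ n₂ with confluent r₁ r₂
    ... | _ , ε     , ε     = ≡.refl
    ... | _ , s ◅ _ , _     = ⊥-elim (n₁ (_ , s))
    ... | _ , ε     , s ◅ _ = ⊥-elim (n₂ (_ , s))

    nf-⟶ : ∀ {w w₁ w₂} → w ⟶ w₁ → w ⟶ w₂ → nf w₁ ≡ nf w₂
    nf-⟶ {w₁ = w₁} {w₂} s₁ s₂ =
      unique (s₁ ◅ path⇒↠ (proj₂ (path w₁))) (path⇒normal (proj₂ (path w₁)))
             (s₂ ◅ path⇒↠ (proj₂ (path w₂))) (path⇒normal (proj₂ (path w₂)))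

    nf-triple : ∀ u v t → .(u⋪v : u ⋪ v) .(v⋪t : v ⋪ t) →
                nf (𝓡N u v ++ [ t ]) ≡ nf ([ u ] ++ 𝓡N v t)
    nf-triple u v t u⋪v v⋪t = nf-⟶
      (whisker [] (α u v u⋪v) [ t ])
      (subst (λ w → u ∷ v ∷ t ∷ [] ⟶ u ∷ w) (++-identityʳ (𝓡N v t))
             (whisker [ u ] (α v t v⋪t) []))

record ReducibleTriple (n : ℕ) : Set where
  constructor 𝓧
  field
    u v t : Row n
    .u⋪v  : u ⋪ v
    .v⋪t  : v ⋪ t

-- Convergence of Σrow n is what makes the paths Λ total and the two sides of
-- each 3-cell parallel.  Neither Λ w nor its target depends on the proof of
-- convergence: the leftmost path from a given word is unique.
Σrowcoh : (n : ℕ) → 2-Polygraph.Convergent (Σrow n) → [3,1]-Polygraph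
Σrowcoh n convergent = record
  { Σ  = Σrow n
  ; Σ₃ = ReducibleTriple n
  ; ∂⁻ = λ (𝓧 u v t _ _) → u ∷ v ∷ t ∷ []
  ; ∂⁺ = λ (𝓧 u v t _ _) → nf ([ u ] ++ 𝓡N v t)
  ; s₂ = λ (𝓧 u v t u⋪v v⋪t) →
      subst (u ∷ v ∷ t ∷ [] ⇒_) (nf-triple u v t u⋪v v⋪t)
            ((gen (α u v u⋪v) ⋆₀ id [ t ]) ⋆₁ Λ (𝓡N u v ++ [ t ]))
  ; t₂ = λ (𝓧 u v t u⋪v v⋪t) →
      (id [ u ] ⋆₀ gen (α v t v⋪t)) ⋆₁ Λ ([ u ] ++ 𝓡N v t)
  }
  where
  open 2-Polygraph (Σrow n)
  open Normalisation convergent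

{-# OPTIONS --safe #-}

-- A row p acts as a transducer on words: inserting x replaces p by p ∪ {x} and
-- emits the letter bumped by x.  This action is compatible with the stylic
-- relations, so the rows of N(w) depend only on the class of w, and distinct
-- tableaux have inequivalent readings.  Conversely w is equivalent to the reading
-- of N(w).  Together with termination this gives the confluence of Σrow n and the
-- isomorphism of the presented monoid with Styl n.
--
-- For the 3-cells, Squier's argument: by Noetherian induction every 2-cell f
-- satisfies f ⋆₁ Λ v ≋ Λ u, where only the branchings of an arbitrary step with the
-- leftmost step need to be filled.  Such a branching is trivial, disjoint, or a
-- whiskered overlap of α u v and α v t, which is filled by 𝓧 u v t.

module Submission where

open import Defs
open import Data.Empty using (⊥-elim; ⊥-elim-irr)
open import Data.Fin.Base using (Fin; zero; suc; toℕ; _<_; _≤_)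
open import Data.Fin.Properties
  using ( _<?_; _≤?_; any?; toℕ<n; <-cmp; ≤-refl; ≤-trans; ≤-antisym; <-trans; <-irrefl
        ; 2↔Bool; *↔×)
open import Data.Fin.Subset
  using (Subset; inside; outside; _∈_; _⊆_; _⊂_; _∪_; ⁅_⁆; Nonempty; ⊥; ∣_∣)
open import Data.Fin.Subset.Properties
  using ( _∈?_; nonempty?; x∈⁅x⁆; x∈⁅y⁆⇒x≡y; p⊆p∪q; q⊆p∪q; x∈p∪q⁻; x∈p∪q⁺
        ; ∪-assoc; ∪-comm; ∪-idem; ∪-identityˡ; ⊆-antisym; ∉⊥; p⊂q⇒∣p∣<∣q∣; ∣p∣≤n)
open import Data.Irrelevant using () renaming ([_] to irr)
open import Data.List.Base
  using ( List; []; _∷_; [_]; _++_; allFin; concatMap; filter; foldl; fromMaybe; head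
        ; length; map; reverse)
open import Data.List.Membership.Propositional using () renaming (_∈_ to _∈ˡ_)
open import Data.List.Membership.Propositional.Properties
  using (∈-allFin; ∈-filter⁺; ∈-filter⁻; ∈-++⁺ˡ; ∈-++⁺ʳ)
open import Data.List.Properties
  using ( ++-assoc; ++-identityʳ; concatMap-++; filter-accept; filter-reject
        ; unfold-reverse)
open import Data.List.Relation.Binary.Sublist.Propositional using ([]; _∷_; _∷ʳ_)
  renaming (_⊆_ to _⊑_; lookup to ⊑-lookup; ⊆-refl to ⊑-refl)
open import Data.List.Relation.Binary.Sublist.Propositional.Properties using (filter⁺)
open import Data.List.Relation.Unary.All as All using (All; []; _∷_)
open import Data.List.Relation.Unary.All.Properties using (all-filter)
open import Data.List.Relation.Unary.AllPairs as AllPairs using (AllPairs; []; _∷_)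
import Data.List.Relation.Unary.AllPairs.Properties as AllPairs
open import Data.List.Relation.Unary.Any using (here; there)
open import Data.List.Relation.Unary.Linked using (Linked; []; [-]; _∷_)
open import Data.List.Reverse using (Reverse; []; _∶_∶ʳ_; reverseView)
open import Data.Maybe.Base using (Maybe; just; nothing; maybe′)
open import Data.Nat.Base as ℕ
  using (ℕ; zero; suc; z≤n; s≤s; _+_; _*_; _∸_; _^_; NonZero; _≥_)
import Data.Nat.Induction as ℕ
import Data.Nat.Properties as ℕ
open import Data.Nat.Tactic.RingSolver using (solve-∀)
open import Data.Product.Base using (Σ-syntax; ∃; _×_; _,_; proj₁; proj₂; uncurry)
open import Data.Product.Function.NonDependent.Propositional using (_×-↔_)
open import Data.Product.Relation.Binary.Lex.Strict using (×-Lex; ×-wellFounded)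
open import Data.Refinement.Base using (Refinement; _,_; value; proof)
open import Data.Sum.Base using (_⊎_; inj₁; inj₂; [_,_]′)
open import Data.Vec.Base using ([]; _∷_; here; there)
open import Function.Base using (flip; _∘_; _on_)
open import Function.Bundles using (_↔_; Inverse; mk↔ₛ′)
open import Function.Properties.Inverse using (↔-sym; ↔-trans)
open import Induction.WellFounded using (WellFounded; Acc; acc; module Subrelation)
open import Relation.Binary.Construct.Closure.ReflexiveTransitive using (Star; ε; _◅_; _◅◅_)
open import Relation.Binary.Construct.Closure.Transitive as Plus using (TransClosure)
import Relation.Binary.Construct.On as On
open import Relation.Binary.Definitions using (tri<; tri≈; tri>)
open import Relation.Binary.PropositionalEquality as ≡ using (_≡_; subst; subst₂)
open import Relation.Binary.Rewriting using (StronglyNormalizing; Confluent)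
open import Relation.Nullary using (¬_; yes; no; contradiction; ¬?; _×-dec_)
open import Relation.Nullary.Decidable using (decidable-stable)
open import Relation.Nullary.Negation using (contradiction-irr)
open import Relation.Unary using (Decidable)

open Row using (supp)

-- 3-cells between 2-cells with propositionally equal boundaries

module HeterogeneousCells (P : [3,1]-Polygraph) where

  open [3,1]-Polygraph P

  infix 4 _≋_

  -- Relating 2-cells whose boundaries are only propositionally equal makes the
  -- juxtaposition of words strictly associative and unital in what follows.
  data _≋_ {u v} (f : u ⇒ v) : ∀ {u′ v′} → u′ ⇒ v′ → Set where
    ⟨_⟩ : {g : u ⇒ v} → f ⇛ g → f ≋ g

  private
    variable
      u v w u′ v′ w′ u″ v″ : Word

  ≋⇒⇛ : {f g : u ⇒ v} → f ≋ g → f ⇛ g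
  ≋⇒⇛ ⟨ A ⟩ = A

  ≋-target : {f : u ⇒ v} {g : u′ ⇒ v′} → f ≋ g → v ≡ v′
  ≋-target ⟨ _ ⟩ = ≡.refl

  ≈⇒≋ : {f g : u ⇒ v} → f ≈ g → f ≋ g
  ≈⇒≋ f≈g = ⟨ identity f≈g ⟩

  ≋-refl : {f : u ⇒ v} → f ≋ f
  ≋-refl = ≈⇒≋ refl

  ≋-sym : {f : u ⇒ v} {g : u′ ⇒ v′} → f ≋ g → g ≋ f
  ≋-sym ⟨ A ⟩ = ⟨ A ⁻¹ ⟩

  ≋-trans : {f : u ⇒ v} {g : u′ ⇒ v′} {h : u″ ⇒ v″} → f ≋ g → g ≋ h → f ≋ h
  ≋-trans ⟨ A ⟩ ⟨ B ⟩ = ⟨ A ⋆₂ B ⟩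

  infixr 2 _≋⟨_⟩_
  infix  3 _∎

  _≋⟨_⟩_ : (f : u ⇒ v) {g : u′ ⇒ v′} {h : u″ ⇒ v″} → f ≋ g → g ≋ h → f ≋ h
  f ≋⟨ A ⟩ B = ≋-trans A B

  _∎ : (f : u ⇒ v) → f ≋ f
  f ∎ = ≋-refl

  ⋆₁-cong≋ : {f : u ⇒ v} {g : v ⇒ w} {f′ : u′ ⇒ v′} {g′ : v′ ⇒ w′} →
             f ≋ f′ → g ≋ g′ → f ⋆₁ g ≋ f′ ⋆₁ g′
  ⋆₁-cong≋ ⟨ A ⟩ ⟨ B ⟩ = ⟨ A ⋆₁ B ⟩

  ⋆₀-cong≋ : {f : u ⇒ v} {g : w ⇒ w′} {f′ : u′ ⇒ v′} {g′ : u″ ⇒ v″} →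
             f ≋ f′ → g ≋ g′ → f ⋆₀ g ≋ f′ ⋆₀ g′
  ⋆₀-cong≋ ⟨ A ⟩ ⟨ B ⟩ = ⟨ A ⋆₀ B ⟩

  subst₂-≋ : (p : u ≡ u′) (q : v ≡ v′) (f : u ⇒ v) → subst₂ _⇒_ p q f ≋ f
  subst₂-≋ ≡.refl ≡.refl f = ≋-refl

  subst-≋ : (q : v ≡ v′) (f : u ⇒ v) → subst (u ⇒_) q f ≋ f
  subst-≋ ≡.refl f = ≋-refl

  ⋆₀-assoc≋ : (f : u ⇒ u′) (g : v ⇒ v′) (h : w ⇒ w′) →
              (f ⋆₀ g) ⋆₀ h ≋ f ⋆₀ (g ⋆₀ h)
  ⋆₀-assoc≋ {u} {u′} {v} {v′} {w} {w′} f g h =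
    ≋-trans (≋-sym (subst₂-≋ (++-assoc u v w) (++-assoc u′ v′ w′) ((f ⋆₀ g) ⋆₀ h)))
            (≈⇒≋ (⋆₀-assoc f g h))

  ⋆₀-identityˡ≋ : (f : u ⇒ v) → id [] ⋆₀ f ≋ f
  ⋆₀-identityˡ≋ f = ≈⇒≋ (⋆₀-identityˡ f)

  ⋆₀-identityʳ≋ : (f : u ⇒ v) → f ⋆₀ id [] ≋ f
  ⋆₀-identityʳ≋ f = ≋-trans (≋-sym (subst₂-≋ (++-identityʳ _) (++-identityʳ _) _))
                            (≈⇒≋ (⋆₀-identityʳ f))

  ⋆₀-id≋ : ∀ u {v} (f : w ⇒ w′) → id u ⋆₀ (id v ⋆₀ f) ≋ id (u ++ v) ⋆₀ f
  ⋆₀-id≋ u {v} f = ≋-trans (≋-sym (⋆₀-assoc≋ (id u) (id v) f))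
                           (⋆₀-cong≋ (≈⇒≋ (⋆₀-id u v)) ≋-refl)

  ⋆₀-id≋ʳ : ∀ (f : w ⇒ w′) u v → (f ⋆₀ id u) ⋆₀ id v ≋ f ⋆₀ id (u ++ v)
  ⋆₀-id≋ʳ f u v = ≋-trans (⋆₀-assoc≋ f (id u) (id v))
                          (⋆₀-cong≋ ≋-refl (≈⇒≋ (⋆₀-id u v)))

  whiskerˡ-⋆₁ : ∀ l (f : u ⇒ v) (g : v ⇒ w) →
                id l ⋆₀ (f ⋆₁ g) ≋ (id l ⋆₀ f) ⋆₁ (id l ⋆₀ g)
  whiskerˡ-⋆₁ l f g = ≈⇒≋ (trans (⋆₀-cong (sym (⋆₁-identityˡ (id l))) refl)
                                 (interchange (id l) (id l) f g))

  whiskerʳ-⋆₁ : ∀ (f : u ⇒ v) (g : v ⇒ w) r →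
                (f ⋆₁ g) ⋆₀ id r ≋ (f ⋆₀ id r) ⋆₁ (g ⋆₀ id r)
  whiskerʳ-⋆₁ f g r = ≈⇒≋ (trans (⋆₀-cong refl (sym (⋆₁-identityˡ (id r))))
                                 (interchange f g (id r) (id r)))

  exchange : (f : u ⇒ u′) (g : v ⇒ v′) →
             (id u ⋆₀ g) ⋆₁ (f ⋆₀ id v′) ≋ (f ⋆₀ id v) ⋆₁ (id u′ ⋆₀ g)
  exchange f g = ≈⇒≋ (trans (sym (interchange _ _ _ _)) (trans
    (⋆₀-cong (trans (⋆₁-identityˡ f) (sym (⋆₁-identityʳ f)))
             (trans (⋆₁-identityʳ g) (sym (⋆₁-identityˡ g))))
    (interchange _ _ _ _)))

  ⋆₀-split : (f : u ⇒ u′) (g : v ⇒ v′) → f ⋆₀ g ≋ (f ⋆₀ id v) ⋆₁ (id u′ ⋆₀ g)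
  ⋆₀-split f g = ≈⇒≋ (trans
    (⋆₀-cong (sym (⋆₁-identityʳ f)) (sym (⋆₁-identityˡ g))) (interchange _ _ _ _))

  ⋆₁-assoc≋ : (f : u ⇒ v) (g : v ⇒ w) (h : w ⇒ w′) →
              (f ⋆₁ g) ⋆₁ h ≋ f ⋆₁ (g ⋆₁ h)
  ⋆₁-assoc≋ f g h = ≈⇒≋ (⋆₁-assoc f g h)

  ⋆₁-cancelʳ : {f g : u ⇒ v} (h : v ⇒ w) → f ⋆₁ h ≋ g ⋆₁ h → f ≋ g
  ⋆₁-cancelʳ {f = f} {g} h A =
    f                  ≋⟨ ≋-sym (undo f) ⟩
    (f ⋆₁ h) ⋆₁ h ⁻¹   ≋⟨ ⋆₁-cong≋ A ≋-refl ⟩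
    (g ⋆₁ h) ⋆₁ h ⁻¹   ≋⟨ undo g ⟩
    g                  ∎
    where
    undo : ∀ k → (k ⋆₁ h) ⋆₁ h ⁻¹ ≋ k
    undo k = ≈⇒≋ (trans (⋆₁-assoc k h (h ⁻¹))
                 (trans (⋆₁-cong refl (⋆₁-inverseʳ h)) (⋆₁-identityʳ k)))

  -- Forward 2-cells and joinable branchings

  cell : u ⟶ v → u ⇒ v
  cell (whisker l β r) = id l ⋆₀ (gen β ⋆₀ id r)

  -- Up to 3-cells, a composite of rewriting steps without inverses. All words met along it are
  -- reducts of its source, which is what the Noetherian induction needs.
  data Forward {u v} (f : u ⇒ v) : Set where
    stop : f ≋ id w → Forward f
    step : (s : w ⟶ w′) {f₁ : u ⇒ u′} {f₂ : u′ ⇒ v} →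
           f₁ ≋ cell s → f ≋ f₁ ⋆₁ f₂ → Forward f₂ → Forward f

  Forward-cell : {f : u ⇒ v} (s : w ⟶ w′) → f ≋ cell s → Forward f
  Forward-cell s A = step s A (≋-sym (≈⇒≋ (⋆₁-identityʳ _))) (stop ≋-refl)

  Forward-⋆₁ : {f : u ⇒ v} {g : v ⇒ w} → Forward f → Forward g → Forward (f ⋆₁ g)
  Forward-⋆₁ {g = g} (stop ⟨ A ⟩) G =
    resp (≋-trans (⋆₁-cong≋ ⟨ A ⟩ ≋-refl) (≈⇒≋ (⋆₁-identityˡ g))) G
    where
    resp : {f g : u ⇒ v} → f ≋ g → Forward g → Forward f
    resp A (stop B)       = stop (≋-trans A B)
    resp A (step s B C F) = step s B (≋-trans A C) F
  Forward-⋆₁ (step s A B F) G =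
    step s A (≋-trans (⋆₁-cong≋ B ≋-refl) (⋆₁-assoc≋ _ _ _)) (Forward-⋆₁ F G)

  cell-whiskerˡ : ∀ x (s : u ⟶ v) → ∃ λ (s′ : x ∷ u ⟶ x ∷ v) → cell s′ ≋ id [ x ] ⋆₀ cell s
  cell-whiskerˡ x (whisker l β r) =
    whisker (x ∷ l) β r , ≋-sym (⋆₀-id≋ [ x ] _)

  cell-whiskerˡ* : ∀ m (s : u ⟶ v) → ∃ λ (s′ : m ++ u ⟶ m ++ v) → cell s′ ≋ id m ⋆₀ cell s
  cell-whiskerˡ* []      s = s , ≋-sym (⋆₀-identityˡ≋ _)
  cell-whiskerˡ* (x ∷ m) s with cell-whiskerˡ* m s
  ... | s₁ , A with cell-whiskerˡ x s₁
  ...   | s₂ , B = s₂ , ≋-trans B (≋-trans (⋆₀-cong≋ ≋-refl A) (⋆₀-id≋ [ x ] _))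

  Forward-whiskerˡ : ∀ x {f : u ⇒ v} → Forward f → Forward (id [ x ] ⋆₀ f)
  Forward-whiskerˡ x (stop A) =
    stop (≋-trans (⋆₀-cong≋ ≋-refl A) (≈⇒≋ (⋆₀-id [ x ] _)))
  Forward-whiskerˡ x (step s A B F) with cell-whiskerˡ x s
  ... | s′ , C = step s′
    (≋-trans (⋆₀-cong≋ ≋-refl A) (≋-sym C))
    (≋-trans (⋆₀-cong≋ ≋-refl B) (whiskerˡ-⋆₁ [ x ] _ _))
    (Forward-whiskerˡ x F)

  Forward-whiskerʳ : ∀ m {f : u ⇒ v} → Forward f → Forward (f ⋆₀ id m)
  Forward-whiskerʳ m (stop A) =
    stop (≋-trans (⋆₀-cong≋ A ≋-refl) (≈⇒≋ (⋆₀-id _ m)))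
  Forward-whiskerʳ m (step (whisker l β r) A B F) = step (whisker l β (r ++ m))
    (≋-trans (⋆₀-cong≋ A ≋-refl)
      (≋-trans (⋆₀-assoc≋ (id l) (gen β ⋆₀ id r) (id m))
               (⋆₀-cong≋ ≋-refl (⋆₀-id≋ʳ (gen β) r m))))
    (≋-trans (⋆₀-cong≋ B ≋-refl) (whiskerʳ-⋆₁ _ _ m))
    (Forward-whiskerʳ m F)

  -- `f₁` and `g₁` allow the targets of `f` and `g` to be rebracketed words. The closing cells `f₂`
  -- and `g₂` are forward so that the induction hypothesis reaches them.
  record Joinable (f : u ⇒ v) (g : u ⇒ w) : Set where
    constructor join
    field
      {v₁ v₂ w₁ w₂} : Word
      {f₁}     : u ⇒ v₁
      {f₂}     : v₁ ⇒ v₂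
      {g₁}     : u ⇒ w₁
      {g₂}     : w₁ ⇒ w₂
      f≋f₁     : f ≋ f₁
      g≋g₁     : g ≋ g₁
      forwardˡ : Forward f₂
      forwardʳ : Forward g₂
      joined   : f₁ ⋆₁ f₂ ≋ g₁ ⋆₁ g₂

  Joinable-whiskerˡ : ∀ x {f : u ⇒ v} {g : u ⇒ w} →
                      Joinable f g → Joinable (id [ x ] ⋆₀ f) (id [ x ] ⋆₀ g)
  Joinable-whiskerˡ x (join A B F G C) = join
    (⋆₀-cong≋ ≋-refl A) (⋆₀-cong≋ ≋-refl B)
    (Forward-whiskerˡ x F) (Forward-whiskerˡ x G)
    (≋-trans (≋-sym (whiskerˡ-⋆₁ [ x ] _ _))
             (≋-trans (⋆₀-cong≋ ≋-refl C) (whiskerˡ-⋆₁ [ x ] _ _)))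

  Joinable-≋ : {f f′ : u ⇒ v} {g g′ : u ⇒ w} →
               f ≋ f′ → g ≋ g′ → Joinable f′ g′ → Joinable f g
  Joinable-≋ A B (join A′ B′ F G C) = join (≋-trans A A′) (≋-trans B B′) F G C

  -- Squier's theorem

  module Squier
    (terminating : StronglyNormalizing _⟶_)
    (nf : Word → Word) (σ : ∀ w → w ⇒ nf w)
    -- Each step is compared with one chosen cell `g` already compatible with `σ`, rather than with
    -- every other step.
    (branching : ∀ {u v} (s : u ⟶ v) → ∃ λ w → ∃ λ (g : u ⇒ w) →
                 u ⟶ w × g ⋆₁ σ w ≋ σ u × Joinable (cell s) g)
    where

    private
      _⟵⁺_ : Word → Word → Set
      _⟵⁺_ = TransClosure (flip _⟶_)

    -- Two parallel 2-cells with this property agree after composition with the invertible cell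
    -- `σ v`, hence are joined by a 3-cell.
    Coherent : u ⇒ v → Set
    Coherent {u} {v} f = f ⋆₁ σ v ≋ σ u

    Coherent-≋ : {f : u ⇒ v} {g : u′ ⇒ v′} → f ≋ g → Coherent g → Coherent f
    Coherent-≋ ⟨ A ⟩ B = ≋-trans (⋆₁-cong≋ ⟨ A ⟩ ≋-refl) B

    Coherent-id : Coherent (id u)
    Coherent-id = ≈⇒≋ (⋆₁-identityˡ _)

    Coherent-⋆₁ : {f : u ⇒ v} {g : v ⇒ w} → Coherent f → Coherent g → Coherent (f ⋆₁ g)
    Coherent-⋆₁ A B = ≋-trans (⋆₁-assoc≋ _ _ _) (≋-trans (⋆₁-cong≋ ≋-refl B) A)

    Coherent-cancelʳ : {f : u ⇒ v} {g : v ⇒ w} →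
                       Coherent g → Coherent (f ⋆₁ g) → Coherent f
    Coherent-cancelʳ A B =
      ≋-trans (⋆₁-cong≋ ≋-refl (≋-sym A)) (≋-trans (≋-sym (⋆₁-assoc≋ _ _ _)) B)

    CoherentAt : Word → Set
    CoherentAt u = ∀ {v} (s : u ⟶ v) → Coherent (cell s)

    forward-coherent : (∀ {x} → Star _⟶_ u x → CoherentAt x) →
                       {f : u ⇒ v} → Forward f → Coherent f
    forward-coherent hyp (stop A) = Coherent-≋ A Coherent-id
    forward-coherent hyp (step s ⟨ A ⟩ B F) =
      Coherent-≋ B (Coherent-⋆₁ (Coherent-≋ ⟨ A ⟩ (hyp ε s)) (forward-coherent (hyp ∘ (s ◅_)) F))

    -- Followed by its closing cell, `cell s` is coherent, being joined by a 3-cell to `g` followed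
    -- by the other closing cell; the first closing cell is then cancelled. Closing cells may take
    -- several steps, hence induction along the transitive closure.
    step-coherent : Acc _⟵⁺_ u → CoherentAt u
    step-coherent {u} (acc rec) s with branching s
    ... | w , g , t , G , join A B F F′ C =
      Coherent-≋ A (Coherent-cancelʳ (forward-coherent (reach s (≋-target A)) F)
        (Coherent-≋ C (Coherent-⋆₁ (Coherent-≋ (≋-sym B) G)
          (forward-coherent (reach t (≋-target B)) F′))))
      where
      below : ∀ {v w} → v ⟵⁺ u → Star _⟶_ v w → w ⟵⁺ u
      below p ε        = p
      below p (s ◅ ss) = below (s Plus.∷ p) ss

      reach : ∀ {v v′ w} → u ⟶ v → v ≡ v′ → Star _⟶_ v′ w → CoherentAt w
      reach s ≡.refl ss = step-coherent (rec (below Plus.[ s ] ss))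

    -- The structural induction carries both contexts because of `⋆₀`: a product splits into two
    -- factors, each whiskered by a boundary of the other, and whiskered generators are rewriting
    -- steps.
    whisker-coherent : ∀ l (f : u ⇒ v) r → Coherent (id l ⋆₀ (f ⋆₀ id r))
    whisker-coherent l (gen β) r =
      step-coherent (Plus.wellFounded _ terminating _) (whisker l β r)
    whisker-coherent l (id u) r = Coherent-≋
      (≋-trans (⋆₀-cong≋ ≋-refl (≈⇒≋ (⋆₀-id u r))) (≈⇒≋ (⋆₀-id l (u ++ r))))
      Coherent-id
    whisker-coherent l (f ⋆₁ g) r = Coherent-≋
      (≋-trans (⋆₀-cong≋ ≋-refl (whiskerʳ-⋆₁ f g r)) (whiskerˡ-⋆₁ l _ _))
      (Coherent-⋆₁ (whisker-coherent l f r) (whisker-coherent l g r))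
    whisker-coherent l (_⋆₀_ {u} {u′} {v} {v′} f g) r = Coherent-≋
      (≋-trans (⋆₀-cong≋ ≋-refl (≋-trans (⋆₀-cong≋ (⋆₀-split f g) ≋-refl) (whiskerʳ-⋆₁ _ _ r)))
               (whiskerˡ-⋆₁ l _ _))
      (Coherent-⋆₁
        (Coherent-≋ (⋆₀-cong≋ ≋-refl (⋆₀-id≋ʳ f v r)) (whisker-coherent l f (v ++ r)))
        (Coherent-≋ (≋-trans (⋆₀-cong≋ ≋-refl (⋆₀-assoc≋ (id u′) g (id r))) (⋆₀-id≋ l _))
                    (whisker-coherent (l ++ u′) g r)))
    -- The whiskered inverse followed by the whiskered `f` is an identity, and the coherent second
    -- factor cancels.
    whisker-coherent l (_⁻¹ {u} {v} f) r = Coherent-cancelʳ (whisker-coherent l f r)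
      (Coherent-≋
        (≋-trans (≋-sym (≋-trans (⋆₀-cong≋ ≋-refl (whiskerʳ-⋆₁ _ _ r)) (whiskerˡ-⋆₁ l _ _)))
        (≋-trans (⋆₀-cong≋ ≋-refl (⋆₀-cong≋ (≈⇒≋ (⋆₁-inverseˡ f)) ≋-refl))
        (≋-trans (⋆₀-cong≋ ≋-refl (≈⇒≋ (⋆₀-id v r))) (≈⇒≋ (⋆₀-id l (v ++ r))))))
        Coherent-id)

    coherent : (f : u ⇒ v) → Coherent f
    coherent f = Coherent-≋ (≋-sym (≋-trans (⋆₀-identityˡ≋ _) (⋆₀-identityʳ≋ f)))
                            (whisker-coherent [] f [])

    homotopyBasis : IsHomotopyBasis
    homotopyBasis f g = ≋⇒⇛ (⋆₁-cancelʳ (σ _) (≋-trans (coherent f) (≋-sym (coherent g))))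

-- Branchings of the row presentation

module RowCoherence (n : ℕ) (convergent : 2-Polygraph.Convergent (Σrow n)) where

  open [3,1]-Polygraph (Σrowcoh n convergent)
  open HeterogeneousCells (Σrowcoh n convergent)
  open Normalisation convergent

  stepCell-unique : ∀ {w w₁ w₂} (s : LeftmostStep w w₁) (t : LeftmostStep w w₂) →
                    stepCell s ≋ stepCell t
  stepCell-unique (here u v w _)   (here .u .v .w _) = ≋-refl
  stepCell-unique (here u v w u⋪v) (there u◁v t)     = ⊥-elim-irr (u⋪v u◁v)
  stepCell-unique (there u◁v s) (here u v w u⋪v)     = ⊥-elim-irr (u⋪v u◁v)
  stepCell-unique (there _ s)   (there _ t)          = ⋆₀-cong≋ ≋-refl (stepCell-unique s t)

  pathCell-unique : ∀ {w w₁ w₂} (p : LeftmostPath w w₁) (q : LeftmostPath w w₂) →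
                    pathCell p ≋ pathCell q
  pathCell-unique (done _)   (done _)   = ≋-refl
  pathCell-unique (done lnk) (t ∷ _)    = ⊥-elim (linked⇒normal lnk (_ , step⇒⟶ t))
  pathCell-unique (s ∷ _)    (done lnk) = ⊥-elim (linked⇒normal lnk (_ , step⇒⟶ s))
  pathCell-unique (s ∷ p)    (t ∷ q)    = combine (stepCell-unique s t) p q
    where
    combine : ∀ {w w₁ w₂ v₁ v₂} {f : w ⇒ w₁} {g : w ⇒ w₂} → f ≋ g →
              (p : LeftmostPath w₁ v₁) (q : LeftmostPath w₂ v₂) →
              f ⋆₁ pathCell p ≋ g ⋆₁ pathCell q
    combine ⟨ A ⟩ p q = ⋆₁-cong≋ ⟨ A ⟩ (pathCell-unique p q)

  stepCell-forward : ∀ {w w′} (s : LeftmostStep w w′) → Forward (stepCell s)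
  stepCell-forward (here u v w u⋪v) =
    Forward-cell (whisker [] (α u v u⋪v) w) (≋-sym (⋆₀-identityˡ≋ _))
  stepCell-forward (there {u} _ s)  = Forward-whiskerˡ u (stepCell-forward s)

  pathCell-forward : ∀ {w ŵ} (p : LeftmostPath w ŵ) → Forward (pathCell p)
  pathCell-forward (done _) = stop ≋-refl
  pathCell-forward (s ∷ p)  = Forward-⋆₁ (stepCell-forward s) (pathCell-forward p)

  Λ-forward : ∀ w → Forward (Λ w)
  Λ-forward w = pathCell-forward (proj₂ (path w))

  Joinable-refl : ∀ {u v v′} {f : u ⇒ v} {g : u ⇒ v′} → f ≋ g → Joinable f g
  Joinable-refl A = join A ≋-refl (stop ≋-refl) (stop ≋-refl) ≋-refl

  -- The branching is filled by `𝓧 u v t` whiskered by `r`; the closing cells are the normalization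
  -- paths in its boundary.
  critical : ∀ u v t r .(u⋪v : u ⋪ v) .(v⋪t : v ⋪ t) →
             Joinable (cell (whisker [ u ] (α v t v⋪t) r)) (gen (α u v u⋪v) ⋆₀ id (t ∷ r))
  critical u v t r u⋪v v⋪t = join
    (≋-sym (⋆₀-assoc≋ (id [ u ]) (gen (α v t v⋪t)) (id r)))
    (≋-sym (⋆₀-id≋ʳ (gen (α u v u⋪v)) [ t ] r))
    (Forward-whiskerʳ r (Λ-forward ([ u ] ++ 𝓡N v t)))
    (Forward-whiskerʳ r (Λ-forward (𝓡N u v ++ [ t ])))
    (≋-trans (≋-sym (whiskerʳ-⋆₁ _ _ r))
    (≋-trans (⋆₀-cong≋ (≋-sym filler) ≋-refl) (whiskerʳ-⋆₁ _ _ r)))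
    where
    filler : (gen (α u v u⋪v) ⋆₀ id [ t ]) ⋆₁ Λ (𝓡N u v ++ [ t ])
             ≋ (id [ u ] ⋆₀ gen (α v t v⋪t)) ⋆₁ Λ ([ u ] ++ 𝓡N v t)
    filler = ≋-trans (≋-sym (subst-≋ (nf-triple u v t u⋪v v⋪t) _))
                     ⟨ gen (𝓧 u v t u⋪v v⋪t) ⟩

  -- Common first rows are peeled off until the leftmost step acts at the front. Then `l` decides:
  -- if it is empty both steps contract the same pair, if it has one row the pairs overlap, and
  -- otherwise they are disjoint.
  joinable : ∀ l β r {w} (s : LeftmostStep (l ++ (s₁ β ++ r)) w) →
             Joinable (cell (whisker l β r)) (stepCell s)
  joinable []      (α u v u⋪v) r (here _ _ _ _)  = Joinable-refl (⋆₀-identityˡ≋ _)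
  joinable []      (α u v u⋪v) r (there u◁v _)   = ⊥-elim-irr (u⋪v u◁v)
  joinable (u ∷ []) (α v t v⋪t) r (here _ _ _ u⋪v) = critical u v t r u⋪v v⋪t
  joinable (u ∷ []) β@(α v t _) r (there _ s) = Joinable-≋
    (≋-sym (⋆₀-id≋ [ u ] _)) ≋-refl (Joinable-whiskerˡ u (joinable [] β r s))
  joinable (u ∷ l@(_ ∷ _)) β r (there _ s) = Joinable-≋
    (≋-sym (⋆₀-id≋ [ u ] _)) ≋-refl (Joinable-whiskerˡ u (joinable l β r s))
  -- Disjoint pairs: the step at `β` is repeated to the right of `𝓡N u v`, and the square commutes
  -- by interchange.
  joinable (u ∷ v ∷ l) β r (here _ _ _ u⋪v)
    with cell-whiskerˡ* (𝓡N u v) (whisker l β r)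
  ... | s′ , A = join
    (≋-sym (⋆₀-id≋ (u ∷ v ∷ []) _)) ≋-refl
    (Forward-cell (whisker [] (α u v u⋪v) (l ++ (t₁ β ++ r))) (≋-sym (⋆₀-identityˡ≋ _)))
    (Forward-cell s′ (≋-sym A))
    (exchange (gen (α u v u⋪v)) (cell (whisker l β r)))

  branch : ∀ {u v ŵ} (p : LeftmostPath u ŵ) (s : u ⟶ v) → ∃ λ w → ∃ λ (g : u ⇒ w) →
           u ⟶ w × g ⋆₁ Λ w ≋ pathCell p × Joinable (cell s) g
  branch (done lnk) s               = ⊥-elim (linked⇒normal lnk (_ , s))
  branch (_∷_ {w′ = w} s₀ p) (whisker l β r) =
    w , stepCell s₀ , step⇒⟶ s₀ ,
    -- `p` need not be the path defining `Λ w`, but all leftmost paths from `w` give the same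
    -- 2-cell.
    ⋆₁-cong≋ ≋-refl (pathCell-unique (proj₂ (path w)) p) ,
    joinable l β r s₀

  open Squier (2-Polygraph.Convergent.terminating convergent) nf Λ
              (λ {u} → branch (proj₂ (path u))) public
    using (homotopyBasis)

private
  variable
    A B : Set
    n : ℕ
    x y z : Fin n
    p q : Subset n
    l l′ w w′ : List (Fin n)

-- Finiteness of the generating sets

Finite-↔ : A ↔ B → Finite B → Finite A
Finite-↔ A↔B (k , B↔Fin) = k , ↔-trans A↔B B↔Fin

Finite-× : Finite A → Finite B → Finite (A × B)
Finite-× (k , A↔) (l , B↔) = k * l , ↔-trans (A↔ ×-↔ B↔) (↔-sym *↔×)

-- Proofs in a `Refinement` are irrelevant, as are those stored in rows, pairs and triples, so
-- elements are counted by value: `zero` adds one exactly when it satisfies `P`.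
Finite-Refinement-Fin : ∀ {k} {P : Fin k → Set} → Decidable P → Finite (Refinement (Fin k) P)
Finite-Refinement-Fin {zero}  P? = 0 , mk↔ₛ′ value (λ ()) (λ ()) (λ { (() , _) })
Finite-Refinement-Fin {suc k} {P} P? with P? zero | Finite-Refinement-Fin (P? ∘ suc)
... | yes p | m , e = suc m , mk↔ₛ′ to′ from′ to∘from from∘to
  where
  open Inverse e
  to′ : Refinement (Fin (suc k)) P → Fin (suc m)
  to′ (zero  , _) = zero
  to′ (suc i , q) = suc (to (i , q))
  from′ : Fin (suc m) → Refinement (Fin (suc k)) P
  from′ zero    = zero , irr p
  from′ (suc j) = suc (value (from j)) , proof (from j)
  to∘from : ∀ j → to′ (from′ j) ≡ j
  to∘from zero    = ≡.refl
  to∘from (suc j) = ≡.cong suc (strictlyInverseˡ j)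
  from∘to : ∀ x → from′ (to′ x) ≡ x
  from∘to (zero  , _) = ≡.refl
  from∘to (suc i , q) = ≡.cong (λ x → suc (value x) , proof x) (strictlyInverseʳ (i , q))
... | no ¬p | m , e = m , mk↔ₛ′ to′ from′ strictlyInverseˡ from∘to
  where
  open Inverse e
  to′ : Refinement (Fin (suc k)) P → Fin m
  to′ (zero  , irr p) = contradiction-irr p ¬p
  to′ (suc i , q)     = to (i , q)
  from′ : Fin m → Refinement (Fin (suc k)) P
  from′ j = suc (value (from j)) , proof (from j)
  from∘to : ∀ x → from′ (to′ x) ≡ x
  from∘to (zero  , irr p) = contradiction-irr p ¬p
  from∘to (suc i , q)     = ≡.cong (λ x → suc (value x) , proof x) (strictlyInverseʳ (i , q))

Finite-Refinement : {P : A → Set} → Decidable P → Finite A → Finite (Refinement A P)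
Finite-Refinement {A} {P} P? (k , e) =
  Finite-↔ transfer (Finite-Refinement-Fin (P? ∘ from))
  where
  open Inverse e
  transfer : Refinement A P ↔ Refinement (Fin k) (P ∘ from)
  transfer = mk↔ₛ′
    (λ { (a , irr p) → to a , irr (subst P (≡.sym (strictlyInverseʳ a)) p) })
    (λ { (i , p) → from i , p })
    (λ { (i , p) → refined (strictlyInverseˡ i) })
    (λ { (a , p) → refined (strictlyInverseʳ a) })
    where
    refined : ∀ {C : Set} {Q : C → Set} {x y : C} .{p : Q x} .{q : Q y} → x ≡ y →
              _≡_ {A = Refinement C Q} (x , irr p) (y , irr q)
    refined ≡.refl = ≡.refl

Finite-Subset : ∀ n → Finite (Subset n)
Finite-Subset zero    = 1 ,
  mk↔ₛ′ (λ _ → zero) (λ _ → []) (λ { zero → ≡.refl }) (λ { [] → ≡.refl })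
Finite-Subset (suc n) = Finite-↔
  (mk↔ₛ′ (λ { (x ∷ p) → x , p }) (uncurry _∷_) (λ _ → ≡.refl) (λ { (_ ∷ _) → ≡.refl }))
  (Finite-× (2 , ↔-sym 2↔Bool) (Finite-Subset n))

Finite-Row : Finite (Row n)
Finite-Row = Finite-↔
  (mk↔ₛ′ (λ { (row p ne) → p , irr ne }) (λ { (p , irr ne) → row p ne })
         (λ _ → ≡.refl) (λ _ → ≡.refl))
  (Finite-Refinement nonempty? (Finite-Subset _))

Finite-ReduciblePair : Finite (ReduciblePair n)
Finite-ReduciblePair = Finite-↔
  (mk↔ₛ′ (λ { (α u v u⋪v) → (u , v) , irr (u⋪v) }) (λ { ((u , v) , irr u⋪v) → α u v u⋪v })
         (λ _ → ≡.refl) (λ _ → ≡.refl))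
  (Finite-Refinement (λ { (u , v) → ¬? (u ◁? v) }) (Finite-× Finite-Row Finite-Row))

Finite-ReducibleTriple : Finite (ReducibleTriple n)
Finite-ReducibleTriple = Finite-↔
  (mk↔ₛ′ (λ { (𝓧 u v t u⋪v v⋪t) → (u , v , t) , irr (u⋪v , v⋪t) })
         (λ { ((u , v , t) , irr p) → 𝓧 u v t (proj₁ p) (proj₂ p) })
         (λ _ → ≡.refl) (λ _ → ≡.refl))
  (Finite-Refinement (λ { (u , v , t) → ¬? (u ◁? v) ×-dec ¬? (v ◁? t) })
    (Finite-× Finite-Row (Finite-× Finite-Row Finite-Row)))

-- Rows acting on words, and the stylic congruence

<⇒≤ : x < y → x ≤ y
<⇒≤ = ℕ.<⇒≤

infix 4 _~_

_~_ : List (Fin n) → List (Fin n) → Set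
_~_ = Congruence StylicRelation

~-reflexive : w ≡ w′ → w ~ w′
~-reflexive ≡.refl = refl

~-++ˡ : ∀ (l : List (Fin n)) → w ~ w′ → l ++ w ~ l ++ w′
~-++ˡ l = cong (refl {u = l})

~-++ʳ : ∀ (r : List (Fin n)) → w ~ w′ → w ++ r ~ w′ ++ r
~-++ʳ r A = cong A (refl {u = r})

elements : Subset n → List (Fin n)
elements p = filter (_∈? p) (allFin _)

Sorted : List (Fin n) → Set
Sorted = AllPairs _<_

elements-sorted : (p : Subset n) → Sorted (elements p)
elements-sorted p = AllPairs.filter⁺ (_∈? p) (AllPairs.tabulate⁺-< λ i<j → i<j)

∈-elements⁺ : x ∈ p → x ∈ˡ elements p
∈-elements⁺ {p = p} = ∈-filter⁺ (_∈? p) (∈-allFin _)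

∈-elements⁻ : x ∈ˡ elements p → x ∈ p
∈-elements⁻ {p = p} = proj₂ ∘ ∈-filter⁻ (_∈? p) {xs = allFin _}

above : Fin n → List (Fin n) → Maybe (Fin n)
above x l = head (filter (x <?_) l)

bump : Fin n → Subset n → Maybe (Fin n)
bump x p = above x (elements p)

data Bump (x : Fin n) (p : Subset n) : Maybe (Fin n) → Set where
  bumps : ∀ {y} → y ∈ p → x < y → (∀ {z} → z ∈ p → x < z → y ≤ z) → Bump x p (just y)
  stays : (∀ {z} → z ∈ p → ¬ x < z) → Bump x p nothing

bump-spec : ∀ x (p : Subset n) → Bump x p (bump x p)
bump-spec x p = spec _ (AllPairs.filter⁺ (x <?_) (elements-sorted p))
  (λ z∈ → let z∈e , x<z = ∈-filter⁻ (x <?_) z∈ in ∈-elements⁻ z∈e , x<z)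
  (λ z∈p x<z → ∈-filter⁺ (x <?_) (∈-elements⁺ z∈p) x<z)
  where
  spec : ∀ l → Sorted l → (∀ {z} → z ∈ˡ l → z ∈ p × x < z) →
         (∀ {z} → z ∈ p → x < z → z ∈ˡ l) → Bump x p (head l)
  spec []      _         _     complete = stays λ z∈p x<z → contradiction (complete z∈p x<z) λ ()
  spec (y ∷ l) (y< ∷ _) sound complete =
    bumps (proj₁ (sound (here ≡.refl))) (proj₂ (sound (here ≡.refl)))
          λ z∈p x<z → least (complete z∈p x<z)
    where
    least : ∀ {z} → z ∈ˡ (y ∷ l) → y ≤ z
    least (here ≡.refl) = ≤-refl
    least (there z∈l)   = <⇒≤ (All.lookup y< z∈l)

Bump-unique : ∀ {m m′} → Bump x p m → Bump x p m′ → m ≡ m′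
Bump-unique (bumps y∈ x<y y≤) (bumps z∈ x<z z≤) =
  ≡.cong just (≤-antisym (y≤ z∈ x<z) (z≤ y∈ x<y))
Bump-unique (bumps y∈ x<y _)  (stays ¬x<)       = contradiction x<y (¬x< y∈)
Bump-unique (stays ¬x<)       (bumps y∈ x<y _)  = contradiction x<y (¬x< y∈)
Bump-unique (stays _)         (stays _)         = ≡.refl

bump≡ : ∀ {m} → Bump x p m → bump x p ≡ m
bump≡ {x = x} {p = p} = Bump-unique (bump-spec x p)

∪⁅⁆-elim : ∀ {P : Set} → x ∈ p ∪ ⁅ y ⁆ → (x ∈ p → P) → (x ≡ y → P) → P
∪⁅⁆-elim {p = p} {y = y} x∈ f g with x∈p∪q⁻ p ⁅ y ⁆ x∈
... | inj₁ x∈p = f x∈p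
... | inj₂ x∈y = g (x∈⁅y⁆⇒x≡y y x∈y)

y∈p∪⁅y⁆ : ∀ (p : Subset n) y → y ∈ p ∪ ⁅ y ⁆
y∈p∪⁅y⁆ p y = q⊆p∪q p ⁅ y ⁆ (x∈⁅x⁆ y)

bump-∪-≥ : ∀ (p : Subset n) → z ≤ x → bump x (p ∪ ⁅ z ⁆) ≡ bump x p
bump-∪-≥ {z = z} {x = x} p z≤x = bump≡ (extend (bump-spec x p))
  where
  extend : ∀ {m} → Bump x p m → Bump x (p ∪ ⁅ z ⁆) m
  extend (bumps y∈ x<y least) = bumps (p⊆p∪q ⁅ z ⁆ y∈) x<y λ a∈ x<a → ∪⁅⁆-elim a∈
    (λ a∈p → least a∈p x<a) (λ { ≡.refl → contradiction x<a (ℕ.≤⇒≯ z≤x) })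
  extend (stays none) = stays λ a∈ x<a → ∪⁅⁆-elim a∈
    (λ a∈p → none a∈p x<a) (λ { ≡.refl → ℕ.≤⇒≯ z≤x x<a })

bump-∪-keep : Bump x p (just y) → y ≤ z → bump x (p ∪ ⁅ z ⁆) ≡ just y
bump-∪-keep {z = z} (bumps y∈ x<y least) y≤z = bump≡ (bumps (p⊆p∪q ⁅ z ⁆ y∈) x<y λ a∈ x<a →
  ∪⁅⁆-elim a∈ (λ a∈p → least a∈p x<a) (λ { ≡.refl → y≤z }))

bump-∪-new : x < z → (∀ {y} → y ∈ p → x < y → z ≤ y) → bump x (p ∪ ⁅ z ⁆) ≡ just z
bump-∪-new {z = z} {p = p} x<z least = bump≡ (bumps (y∈p∪⁅y⁆ p z) x<z λ a∈ x<a →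
  ∪⁅⁆-elim a∈ (λ a∈p → least a∈p x<a) (λ { ≡.refl → ≤-refl }))

absorb : Subset n → List (Fin n) → Subset n
absorb p []      = p
absorb p (x ∷ w) = absorb (p ∪ ⁅ x ⁆) w

out : Subset n → List (Fin n) → List (Fin n)
out p []      = []
out p (x ∷ w) = fromMaybe (bump x p) ++ out (p ∪ ⁅ x ⁆) w

absorb-++ : ∀ (p : Subset n) w w′ → absorb p (w ++ w′) ≡ absorb (absorb p w) w′
absorb-++ p []      w′ = ≡.refl
absorb-++ p (x ∷ w) w′ = absorb-++ (p ∪ ⁅ x ⁆) w w′

out-++ : ∀ (p : Subset n) w w′ → out p (w ++ w′) ≡ out p w ++ out (absorb p w) w′
out-++ p []      w′ = ≡.refl
out-++ p (x ∷ w) w′ = ≡.trans (≡.cong (fromMaybe (bump x p) ++_) (out-++ (p ∪ ⁅ x ⁆) w w′))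
                              (≡.sym (++-assoc (fromMaybe (bump x p)) _ _))

∪-swap : ∀ (p q r : Subset n) → (p ∪ q) ∪ r ≡ (p ∪ r) ∪ q
∪-swap p q r = ≡.trans (∪-assoc p q r)
  (≡.trans (≡.cong (p ∪_) (∪-comm q r)) (≡.sym (∪-assoc p r q)))

out-xx≈x : ∀ (p : Subset n) x → out p (x ∷ x ∷ []) ~ out p (x ∷ [])
out-xx≈x p x rewrite bump-∪-≥ {x = x} p ≤-refl with bump x p
... | nothing = refl
... | just y  = gen (xx≈x y)

-- The two sides differ only in whether `x` is inserted before or after `z`. Either `x` bumps some
-- `a ≤ z`, the same both times, or no letter of `p` lies above `x` and at or below `z`.
out-zxy≈xzy : ∀ (p : Subset n) → x ≤ y → y < z →
              out p (z ∷ x ∷ y ∷ []) ~ out p (x ∷ z ∷ y ∷ [])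
out-zxy≈xzy {x = x} {y} {z} p x≤y y<z
  rewrite ∪-swap p ⁅ x ⁆ ⁅ z ⁆ | bump-∪-≥ {x = y} (p ∪ ⁅ z ⁆) x≤y
        | bump-∪-≥ {x = z} p (≤-trans x≤y (<⇒≤ y<z)) = go (bump-spec x p)
  where
  x<z : x < z
  x<z = ℕ.≤-<-trans x≤y y<z

  shift : (∀ {a} → a ∈ p → x < a → z < a) → ∀ {m} → Bump z p m → Bump x p m
  shift gap (bumps b∈ z<b least) = bumps b∈ (<-trans x<z z<b) λ a∈ x<a → least a∈ (gap a∈ x<a)
  shift gap (stays none)         = stays λ a∈ x<a → none a∈ (gap a∈ x<a)

  -- After `z`, both `x` and `y` bump `z`; before it, `x` bumps what `z` bumps. The outputs `bzz`
  -- and `bbz` agree by idempotence.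
  far : ∀ {m} → Bump x p m → (∀ {a} → a ∈ p → x < a → z < a) →
        fromMaybe (bump z p) ++ fromMaybe (bump x (p ∪ ⁅ z ⁆)) ++
          fromMaybe (bump y (p ∪ ⁅ z ⁆)) ++ [] ~
        fromMaybe m ++ fromMaybe (bump z p) ++ fromMaybe (bump y (p ∪ ⁅ z ⁆)) ++ []
  far {m} X gap
    rewrite bump-∪-new x<z (λ a∈ x<a → <⇒≤ (gap a∈ x<a))
          | bump-∪-new y<z (λ a∈ y<a → <⇒≤ (gap a∈ (ℕ.≤-<-trans x≤y y<a)))
          | Bump-unique X (shift gap (bump-spec z p)) with bump z p
  ... | nothing = gen (xx≈x z)
  ... | just b  = trans (~-++ˡ [ b ] (gen (xx≈x z))) (~-++ʳ [ z ] (sym (gen (xx≈x b))))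

  -- If `z` bumps some `c`, the outputs are `cab` and `acb` with `a ≤ b ≤ z < c`, an instance of the
  -- same relation.
  near : ∀ {a b} → Bump x p (just a) → a ≤ z → Bump y (p ∪ ⁅ z ⁆) b →
         fromMaybe (bump z p) ++ a ∷ fromMaybe b ++ [] ~
         a ∷ fromMaybe (bump z p) ++ fromMaybe b ++ []
  near _ _ (stays none) = contradiction y<z (none (y∈p∪⁅y⁆ p z))
  near {a} (bumps _ _ leastₐ) a≤z (bumps {y = b} b∈ y<b least) with bump z p | bump-spec z p
  ... | nothing | _             = refl
  ... | just c  | bumps _ z<c _ = gen (zxy≈xzy a≤b (ℕ.≤-<-trans (least (y∈p∪⁅y⁆ p z) y<z) z<c))
    where
    a≤b : a ≤ b
    a≤b = ∪⁅⁆-elim b∈ (λ b∈p → leastₐ b∈p (ℕ.≤-<-trans x≤y y<b)) (λ { ≡.refl → a≤z })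

  go : ∀ {m} → Bump x p m →
       fromMaybe (bump z p) ++ fromMaybe (bump x (p ∪ ⁅ z ⁆)) ++
         fromMaybe (bump y (p ∪ ⁅ z ⁆)) ++ [] ~
       fromMaybe m ++ fromMaybe (bump z p) ++ fromMaybe (bump y (p ∪ ⁅ z ⁆)) ++ []
  go X@(stays none) = far X λ a∈ x<a → contradiction x<a (none a∈)
  go X@(bumps {y = a} _ _ least) with a ≤? z
  ... | no  a≰z = far X λ b∈ x<b → ℕ.<-≤-trans (ℕ.≰⇒> a≰z) (least b∈ x<b)
  ... | yes a≤z rewrite bump-∪-keep X a≤z = near X a≤z (bump-spec y (p ∪ ⁅ z ⁆))

-- As `y` is already present, `x` bumps the same `a ≤ y` before and after `z`. If `z` bumps `c`,
-- then `y` bumps some `b` with `a ≤ y < b ≤ c`, and `bca ~ bac` is the same relation.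
out-yzx≈yxz : ∀ (p : Subset n) → x < y → y ≤ z →
              out p (y ∷ z ∷ x ∷ []) ~ out p (y ∷ x ∷ z ∷ [])
out-yzx≈yxz {x = x} {y} {z} p x<y y≤z
  rewrite bump-∪-≥ {x = z} (p ∪ ⁅ y ⁆) (≤-trans (<⇒≤ x<y) y≤z) | bump-∪-≥ {x = z} p y≤z
  = go (bump-spec x (p ∪ ⁅ y ⁆))
  where
  go : ∀ {m} → Bump x (p ∪ ⁅ y ⁆) m →
       fromMaybe (bump y p) ++ fromMaybe (bump z p) ++
         fromMaybe (bump x ((p ∪ ⁅ y ⁆) ∪ ⁅ z ⁆)) ++ [] ~
       fromMaybe (bump y p) ++ fromMaybe m ++ fromMaybe (bump z p) ++ []
  go (stays none) = contradiction x<y (none (y∈p∪⁅y⁆ p y))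
  go X@(bumps {y = a} _ _ least) rewrite bump-∪-keep X (≤-trans (least (y∈p∪⁅y⁆ p y) x<y) y≤z)
    with bump y p | bump-spec y p | bump z p | bump-spec z p
  ... | _       | _                 | nothing | _               = refl
  ... | nothing | stays none        | just c  | bumps c∈ z<c _  =
    contradiction (ℕ.≤-<-trans y≤z z<c) (none c∈)
  ... | just b  | bumps _ y<b least′ | just c  | bumps c∈ z<c _ =
    gen (yzx≈yxz (ℕ.≤-<-trans (least (y∈p∪⁅y⁆ p y) x<y) y<b) (least′ c∈ (ℕ.≤-<-trans y≤z z<c)))

absorb-cong : w ~ w′ → ∀ (p : Subset n) → absorb p w ≡ absorb p w′
absorb-cong (gen (xx≈x x)) p = ≡.trans (∪-assoc p _ _) (≡.cong (p ∪_) (∪-idem ⁅ x ⁆))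
absorb-cong (gen (zxy≈xzy {x} {y} {z} _ _)) p = ≡.cong (_∪ ⁅ y ⁆) (∪-swap p ⁅ z ⁆ ⁅ x ⁆)
absorb-cong (gen (yzx≈yxz {x} {y} {z} _ _)) p = ∪-swap (p ∪ ⁅ y ⁆) ⁅ z ⁆ ⁅ x ⁆
absorb-cong refl        p = ≡.refl
absorb-cong (sym A)     p = ≡.sym (absorb-cong A p)
absorb-cong (trans A B) p = ≡.trans (absorb-cong A p) (absorb-cong B p)
absorb-cong (cong {u} {u′} {v} {v′} A B) p
  rewrite absorb-++ p u v | absorb-++ p u′ v′ | absorb-cong A p = absorb-cong B (absorb p u′)

out-cong : w ~ w′ → ∀ (p : Subset n) → out p w ~ out p w′
out-cong (gen (xx≈x x))         p = out-xx≈x p x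
out-cong (gen (zxy≈xzy x≤y y<z)) p = out-zxy≈xzy p x≤y y<z
out-cong (gen (yzx≈yxz x<y y≤z)) p = out-yzx≈yxz p x<y y≤z
out-cong refl        p = refl
out-cong (sym A)     p = sym (out-cong A p)
out-cong (trans A B) p = trans (out-cong A p) (out-cong B p)
out-cong (cong {u} {u′} {v} {v′} A B) p
  rewrite out-++ p u v | out-++ p u′ v′ | absorb-cong A p =
  cong (out-cong A p) (out-cong B (absorb p u′))

∈-absorbˡ : ∀ w → p ⊆ absorb p w
∈-absorbˡ []      x∈p = x∈p
∈-absorbˡ (_ ∷ w) x∈p = ∈-absorbˡ w (p⊆p∪q _ x∈p)

∈-absorbʳ : ∀ (p : Subset n) → x ∈ˡ w → x ∈ absorb p w
∈-absorbʳ {w = y ∷ w} p (here ≡.refl) = ∈-absorbˡ w (y∈p∪⁅y⁆ p y)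
∈-absorbʳ {w = y ∷ w} p (there x∈w)   = ∈-absorbʳ (p ∪ ⁅ y ⁆) x∈w

∈-absorb⁻ : ∀ (p : Subset n) w → x ∈ absorb p w → x ∈ p ⊎ x ∈ˡ w
∈-absorb⁻ p []      x∈p = inj₁ x∈p
∈-absorb⁻ p (y ∷ w) x∈ with ∈-absorb⁻ (p ∪ ⁅ y ⁆) w x∈
... | inj₁ x∈p∪y = ∪⁅⁆-elim x∈p∪y inj₁ (inj₂ ∘ here)
... | inj₂ x∈w   = inj₂ (there x∈w)

absorb-elements : ∀ (p q : Subset n) → absorb p (elements q) ≡ p ∪ q
absorb-elements p q = ⊆-antisym
  (λ x∈ → x∈p∪q⁺ ([ inj₁ , inj₂ ∘ ∈-elements⁻ ]′ (∈-absorb⁻ p (elements q) x∈)))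
  (λ x∈ → [ ∈-absorbˡ (elements q) , ∈-absorbʳ p ∘ ∈-elements⁺ ]′ (x∈p∪q⁻ p q x∈))

successors : List (Fin n) → List (Fin n) → List (Fin n)
successors l = concatMap (λ x → fromMaybe (above x l))

-- Letters of `w` already absorbed are smaller than the later ones and cannot be bumped by them, so
-- every bump can be computed in the original `p`.
out-sorted : ∀ (p : Subset n) → Sorted w → out p w ≡ successors (elements p) w
out-sorted p []                   = ≡.refl
out-sorted p (_∷_ {x} {w} x< w<) = ≡.cong (fromMaybe (bump x p) ++_)
  (≡.trans (out-sorted (p ∪ ⁅ x ⁆) w<) (go x<))
  where
  go : ∀ {w} → All (x <_) w → successors (elements (p ∪ ⁅ x ⁆)) w ≡ successors (elements p) w
  go []         = ≡.refl
  go (x<y ∷ x<) = ≡.cong₂ (λ m r → fromMaybe m ++ r) (bump-∪-≥ p (<⇒≤ x<y)) (go x<)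

out-increasing : AllPairs _≤_ w → (∀ {x y} → x ∈ p → y ∈ˡ w → x ≤ y) → out p w ≡ []
out-increasing []                   _  = ≡.refl
out-increasing {p = p} (_∷_ {x} {w} x≤ w≤) p≤
  rewrite bump≡ {x = x} {p = p} (stays λ z∈p x<z → ℕ.≤⇒≯ (p≤ z∈p (here ≡.refl)) x<z) =
  out-increasing w≤ λ z∈ y∈w → ∪⁅⁆-elim z∈ (λ z∈p → p≤ z∈p (there y∈w))
                                 (λ { ≡.refl → All.lookup x≤ y∈w })

above-< : All (x <_) l → above x l ≡ head l
above-< {l = []}    []        = ≡.refl
above-< {x = x} {l = y ∷ l} (x<y ∷ _) = ≡.cong head (filter-accept (x <?_) {xs = l} x<y)

above-≮ : ∀ l → ¬ x < y → above x (y ∷ l) ≡ above x l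
above-≮ {x = x} l x≮y = ≡.cong head (filter-reject (x <?_) {xs = l} x≮y)

above⇒< : ∀ l → above x l ≡ just y → x < y
above⇒< {x = x} l eq with filter (x <?_) l | all-filter (x <?_) l
above⇒< l ≡.refl | _ ∷ _ | x<y ∷ _ = x<y

head-absorbs : ∀ (l : List (Fin n)) → fromMaybe (head l) ++ l ~ l
head-absorbs []      = refl
head-absorbs (x ∷ l) = ~-++ʳ l (gen (xx≈x x))

successors-≥ : All (y ≤_) w → successors (y ∷ l) w ≡ successors l w
successors-≥ [] = ≡.refl
successors-≥ {l = l} (y≤z ∷ y≤) =
  ≡.cong₂ (λ m r → fromMaybe m ++ r) (above-≮ l (ℕ.≤⇒≯ y≤z)) (successors-≥ y≤)

-- Every letter of l′ is the successor in l′ of some letter of x ∷ l, and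
-- successors taken in l′ occur in increasing order with repetitions.
successors-⊑ : Sorted (x ∷ l) → l′ ⊑ l → successors l′ (x ∷ l) ~ l′
successors-⊑ _ [] = refl
successors-⊑ {l′ = l′} ((x<y ∷ x<) ∷ y∷l<) (y ∷ʳ l′⊑l)
  rewrite above-< (All.tabulate {xs = l′} λ z∈ → All.lookup x< (⊑-lookup l′⊑l z∈)) =
  trans (~-++ˡ (fromMaybe (head l′)) (successors-⊑ y∷l< l′⊑l)) (head-absorbs l′)
successors-⊑ {x = x} {l = y ∷ l} {l′ = .y ∷ l′} ((x<y ∷ x<) ∷ y<@(y<l ∷ _)) (≡.refl ∷ l′⊑l)
  rewrite ≡.cong fromMaybe (≡.cong head (filter-accept (x <?_) {xs = l′} x<y))
        | successors-≥ {l = l′} (≤-refl ∷ All.map <⇒≤ y<l) =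
  ~-++ˡ [ y ] (successors-⊑ y< l′⊑l)

-- Row insertion derived from the stylic relations

insertSorted : Fin n → List (Fin n) → List (Fin n)
insertSorted x []      = [ x ]
insertSorted x (y ∷ l) with <-cmp x y
... | tri< _ _ _ = x ∷ y ∷ l
... | tri≈ _ _ _ = y ∷ l
... | tri> _ _ _ = y ∷ insertSorted x l

∈-insertSorted⁺ : ∀ l → z ≡ x ⊎ z ∈ˡ l → z ∈ˡ insertSorted x l
∈-insertSorted⁺ []      (inj₁ ≡.refl) = here ≡.refl
∈-insertSorted⁺ {x = x} (y ∷ l) z∈ with <-cmp x y | z∈
... | tri< _ _ _      | inj₁ ≡.refl         = here ≡.refl
... | tri< _ _ _      | inj₂ z∈l            = there z∈l
... | tri≈ _ ≡.refl _ | inj₁ ≡.refl         = here ≡.refl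
... | tri≈ _ _ _      | inj₂ z∈l            = z∈l
... | tri> _ _ _      | inj₁ z≡x            = there (∈-insertSorted⁺ l (inj₁ z≡x))
... | tri> _ _ _      | inj₂ (here z≡y)     = here z≡y
... | tri> _ _ _      | inj₂ (there z∈l)    = there (∈-insertSorted⁺ l (inj₂ z∈l))

All-insertSorted : ∀ {P : Fin n → Set} l → P x → All P l → All P (insertSorted x l)
All-insertSorted []      px []         = px ∷ []
All-insertSorted {x = x} (y ∷ l) px (py ∷ pl) with <-cmp x y
... | tri< _ _ _ = px ∷ py ∷ pl
... | tri≈ _ _ _ = py ∷ pl
... | tri> _ _ _ = py ∷ All-insertSorted l px pl

insertSorted-sorted : ∀ x → Sorted l → Sorted (insertSorted x l)
insertSorted-sorted x [] = [] ∷ []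
insertSorted-sorted x (_∷_ {y} {l} y< l<) with <-cmp x y
... | tri< x<y _ _ = (x<y ∷ All.map (<-trans x<y) y<) ∷ y< ∷ l<
... | tri≈ _ _ _   = y< ∷ l<
... | tri> _ _ y<x = All-insertSorted l y<x y< ∷ insertSorted-sorted x l<

heads-≡ : All (x <_) l → All (y <_) l′ → x ∈ˡ (y ∷ l′) → y ∈ˡ (x ∷ l) → x ≡ y
heads-≡ _  _  (here x≡y)   _            = x≡y
heads-≡ _  _  (there _)    (here y≡x)   = ≡.sym y≡x
heads-≡ x< y< (there x∈l′) (there y∈l)  =
  contradiction (<-trans (All.lookup x< y∈l) (All.lookup y< x∈l′)) (<-irrefl ≡.refl)

Sorted-unique : Sorted l → Sorted l′ → (∀ {x} → x ∈ˡ l → x ∈ˡ l′) →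
                (∀ {x} → x ∈ˡ l′ → x ∈ˡ l) → l ≡ l′
Sorted-unique [] [] _ _ = ≡.refl
Sorted-unique [] (_ ∷ _) _ l′⊆l = contradiction (l′⊆l (here ≡.refl)) λ ()
Sorted-unique (_ ∷ _) [] l⊆l′ _ = contradiction (l⊆l′ (here ≡.refl)) λ ()
Sorted-unique (_∷_ {x} {l} x< l<) (_∷_ {y} {l′} y< l′<) l⊆l′ l′⊆l
  with heads-≡ x< y< (l⊆l′ (here ≡.refl)) (l′⊆l (here ≡.refl))
... | ≡.refl = ≡.cong (x ∷_) (Sorted-unique l< l′< (tail x< l⊆l′) (tail y< l′⊆l))
  where
  tail : ∀ {l l′} → All (x <_) l → (∀ {z} → z ∈ˡ (x ∷ l) → z ∈ˡ (x ∷ l′)) →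
         ∀ {z} → z ∈ˡ l → z ∈ˡ l′
  tail x< ⊆ z∈l with ⊆ (there z∈l)
  ... | here ≡.refl = contradiction (All.lookup x< z∈l) (<-irrefl ≡.refl)
  ... | there z∈l′  = z∈l′

elements-∪⁅⁆ : ∀ (p : Subset n) x → elements (p ∪ ⁅ x ⁆) ≡ insertSorted x (elements p)
elements-∪⁅⁆ p x = Sorted-unique (elements-sorted _) (insertSorted-sorted x (elements-sorted p))
  (λ z∈ → ∪⁅⁆-elim (∈-elements⁻ z∈) (λ z∈p → ∈-insertSorted⁺ (elements p) (inj₂ (∈-elements⁺ z∈p)))
                                     (λ z≡x → ∈-insertSorted⁺ (elements p) (inj₁ z≡x)))
  (λ z∈ → ∈-elements⁺ (All.lookup
    (All-insertSorted {P = _∈ p ∪ ⁅ x ⁆} (elements p) (y∈p∪⁅y⁆ p x)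
      (All.tabulate λ y∈ → p⊆p∪q ⁅ x ⁆ (∈-elements⁻ y∈))) z∈))

-- `x` moves left past each letter of `l` by `yzx = yxz`, which needs a larger letter in front; `y`
-- plays that role last and is not crossed.
pass : x < y → Sorted (y ∷ l) → y ∷ l ++ [ x ] ~ y ∷ x ∷ l
pass {l = []}    x<y _ = refl
pass {l = z ∷ l} x<y ((y<z ∷ y<) ∷ z∷l<) = trans
  (~-++ˡ [ _ ] (pass (<-trans x<y y<z) z∷l<))
  (~-++ʳ l (gen (yzx≈yxz x<y (<⇒≤ y<z))))

-- The single-row case of the equivalence between a word and the reading of its tableau. The bumped
-- letter, if any, is duplicated by idempotence; one copy stays in the row and the other moves to
-- its left.
insertSorted-~ : ∀ x → Sorted l → l ++ [ x ] ~ fromMaybe (above x l) ++ insertSorted x l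
insertSorted-~ x [] = refl
insertSorted-~ x (_∷_ {y} {l} y< l<) with <-cmp x y
... | tri< x<y _ _ rewrite ≡.cong fromMaybe (≡.cong head (filter-accept (x <?_) {xs = l} x<y)) =
  trans (pass x<y (y< ∷ l<))
  (trans (~-++ʳ (x ∷ l) (sym (gen (xx≈x y)))) (~-++ʳ l (gen (yzx≈yxz x<y ≤-refl))))
insertSorted-~ x (_∷_ {y} {l} y< l<) | tri≈ x≮y ≡.refl _
  rewrite above-≮ l x≮y | above-< y< = go y< l<
  where
  go : ∀ {l} → All (x <_) l → Sorted l → x ∷ l ++ [ x ] ~ fromMaybe (head l) ++ x ∷ l
  go [] _ = gen (xx≈x x)
  -- The word `xz⋯x` becomes in turn `xzx⋯`, `zxx⋯`, `zx⋯`, `zzx⋯` and `zxz⋯`.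
  go {z ∷ l} (x<z ∷ _) z∷l<@(z< ∷ _) =
    trans (~-++ˡ [ x ] (pass x<z z∷l<))
    (trans (~-++ʳ l (sym (gen (zxy≈xzy ≤-refl x<z))))
    (trans (~-++ˡ [ z ] (~-++ʳ l (gen (xx≈x x))))
    (trans (~-++ʳ (x ∷ l) (sym (gen (xx≈x z))))
           (~-++ʳ l (gen (yzx≈yxz x<z ≤-refl))))))
insertSorted-~ x (_∷_ {y} {l} y< l<) | tri> x≮y _ y<x rewrite above-≮ l x≮y =
  trans (~-++ˡ [ y ] (insertSorted-~ x l<))
        (go (above⇒< l) (insertSorted-sorted x l<) (∈-insertSorted⁺ l (inj₁ ≡.refl))
            (All-insertSorted l y<x y<))
  where
  -- The bumped letter `z` crosses `y` by `zxy = xzy`. The third letter of that relation is the head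
  -- `w` of the new tail, for which `y ≤ w ≤ x < z`.
  go : ∀ {m l} → (∀ {z} → m ≡ just z → x < z) → Sorted l → x ∈ˡ l → All (y <_) l →
       y ∷ fromMaybe m ++ l ~ fromMaybe m ++ y ∷ l
  go {nothing} _ _ _ _ = refl
  go {just z} {w ∷ l} x<m (w< ∷ _) x∈ (y<w ∷ _) =
    ~-++ʳ l (sym (gen (zxy≈xzy (<⇒≤ y<w) (w<z x∈))))
    where
    w<z : x ∈ˡ (w ∷ l) → w < z
    w<z (here ≡.refl) = x<m ≡.refl
    w<z (there x∈l)   = <-trans (All.lookup w< x∈l) (x<m ≡.refl)

-- N-insertion and readings of tableaux

flatten : List (Row n) → List (Fin n)
flatten = concatMap letters

flatten-∷ʳ : ∀ W (u : Row n) → flatten (W ++ [ u ]) ≡ flatten W ++ letters u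
flatten-∷ʳ W u =
  ≡.trans (concatMap-++ letters W [ u ]) (≡.cong (flatten W ++_) (++-identityʳ (letters u)))

flatten-reverse-∷ : ∀ (u : Row n) T →
                    flatten (reverse (u ∷ T)) ≡ flatten (reverse T) ++ letters u
flatten-reverse-∷ u T = ≡.trans (≡.cong flatten (unfold-reverse u T)) (flatten-∷ʳ (reverse T) u)

elements-⁅⁆ : ∀ (x : Fin n) → elements ⁅ x ⁆ ≡ [ x ]
elements-⁅⁆ x = Sorted-unique (elements-sorted ⁅ x ⁆) ([] ∷ [])
  (here ∘ x∈⁅y⁆⇒x≡y x ∘ ∈-elements⁻) (λ { (here ≡.refl) → ∈-elements⁺ (x∈⁅x⁆ x) })

insert-~ : ∀ x (T : Tableau n) → flatten (reverse (insert x T)) ~ flatten (reverse T) ++ [ x ]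
insert-~ x [] rewrite elements-⁅⁆ x = refl
insert-~ x (u ∷ T) =
  trans (bottom (bumped x u) ≡.refl)
  (trans (~-++ˡ (flatten (reverse T)) (sym (insertSorted-~ x (elements-sorted (supp u)))))
  (~-reflexive (≡.trans (≡.sym (++-assoc _ (letters u) [ x ]))
                        (≡.cong (_++ [ x ]) (≡.sym (flatten-reverse-∷ u T))))))
  where
  bottom : ∀ m → bumped x u ≡ m →
    flatten (reverse (add x u ∷ maybe′ (λ y → insert y T) T m)) ~
    flatten (reverse T) ++ fromMaybe (above x (letters u)) ++ insertSorted x (letters u)
  bottom nothing eq rewrite eq | flatten-reverse-∷ (add x u) T | elements-∪⁅⁆ (supp u) x = refl
  bottom (just y) eq
    rewrite eq | flatten-reverse-∷ (add x u) (insert y T) | elements-∪⁅⁆ (supp u) x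
    = trans (~-++ʳ (insertSorted x (letters u)) (insert-~ y T)) (~-reflexive (++-assoc _ [ y ] _))

insertAll : Tableau n → List (Fin n) → Tableau n
insertAll = foldl (flip insert)

insertAll-~ : ∀ (T : Tableau n) w → flatten (reverse (insertAll T w)) ~ flatten (reverse T) ++ w
insertAll-~ T []      = ~-reflexive (≡.sym (++-identityʳ _))
insertAll-~ T (x ∷ w) = trans (insertAll-~ (insert x T) w)
  (trans (~-++ʳ w (insert-~ x T)) (~-reflexive (++-assoc _ [ x ] w)))

𝓡N-~ : ∀ (u v : Row n) → flatten (𝓡N u v) ~ letters u ++ letters v
𝓡N-~ u v = insertAll-~ [] (letters u ++ letters v)

-- This links insertion to the transducer: the bottom row never depends on the rows above it, so the
-- whole word may pass through it before its output reaches `T`.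
insertAll-∷ : ∀ (u : Row n) T w → ∃ λ r → supp r ≡ absorb (supp u) w ×
              insertAll (u ∷ T) w ≡ r ∷ insertAll T (out (supp u) w)
insertAll-∷ u T []      = u , ≡.refl , ≡.refl
insertAll-∷ u T (x ∷ w) with insertAll-∷ (add x u) (maybe′ (λ y → insert y T) T (bumped x u)) w
... | r , supp≡ , eq = r , supp≡ , ≡.trans eq (≡.cong (r ∷_) (shift (bumped x u)))
  where
  shift : ∀ m {w} → insertAll (maybe′ (λ y → insert y T) T m) w ≡ insertAll T (fromMaybe m ++ w)
  shift nothing  = ≡.refl
  shift (just _) = ≡.refl

-- The empty set acts as a bottom row before the first letter: it bumps nothing and becomes a
-- singleton, in agreement with insertion into the empty tableau.
N-∷ : ∀ (x : Fin n) w → ∃ λ r → supp r ≡ absorb ⊥ (x ∷ w) × N (x ∷ w) ≡ r ∷ N (out ⊥ (x ∷ w))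
N-∷ x w rewrite bump≡ {x = x} {p = ⊥} (stays λ z∈⊥ → contradiction z∈⊥ ∉⊥)
              | ∪-identityˡ ⁅ x ⁆ = insertAll-∷ (singleton x) [] w

N-nonempty : ∀ (w : List (Fin n)) → x ∈ˡ w → ∃ λ r → supp r ≡ absorb ⊥ w × N w ≡ r ∷ N (out ⊥ w)
N-nonempty (x ∷ w) _ = N-∷ x w

-- The tableau of a product of two rows

Sorted⇒≤ : Sorted l → AllPairs _≤_ l
Sorted⇒≤ = AllPairs.map <⇒≤

out-⊥-increasing : AllPairs _≤_ w → out ⊥ w ≡ []
out-⊥-increasing w≤ = out-increasing w≤ λ x∈⊥ → contradiction x∈⊥ ∉⊥

∈-successors⁻ : ∀ l w → y ∈ˡ successors l w → ∃ λ x → x ∈ˡ w × above x l ≡ just y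
∈-successors⁻ l (x ∷ w) y∈ with above x l in eq
∈-successors⁻ l (x ∷ w) (here ≡.refl) | just y  = x , here ≡.refl , eq
∈-successors⁻ l (x ∷ w) (there y∈)    | just _  with ∈-successors⁻ l w y∈
... | x′ , x′∈w , eq′ = x′ , there x′∈w , eq′
∈-successors⁻ l (x ∷ w) y∈            | nothing with ∈-successors⁻ l w y∈
... | x′ , x′∈w , eq′ = x′ , there x′∈w , eq′

∈-successors⁺ : ∀ l {w} → x ∈ˡ w → above x l ≡ just y → y ∈ˡ successors l w
∈-successors⁺ l (here ≡.refl) eq rewrite eq = here ≡.refl
∈-successors⁺ l {z ∷ w} (there x∈w) eq = ∈-++⁺ʳ (fromMaybe (above z l)) (∈-successors⁺ l x∈w eq)

bump-just : bump x p ≡ just y → Bump x p (just y)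
bump-just {x = x} {p = p} eq = subst (Bump x p) eq (bump-spec x p)

successors-increasing : ∀ (p : Subset n) → Sorted w → AllPairs _≤_ (successors (elements p) w)
successors-increasing p [] = []
successors-increasing p (_∷_ {x} {w} x< w<) with bump x p | bump-spec x p
... | nothing | _ = successors-increasing p w<
... | just y  | bumps _ _ least = All.tabulate above-y ∷ successors-increasing p w<
  where
  above-y : ∀ {z} → z ∈ˡ successors (elements p) w → y ≤ z
  above-y z∈ with ∈-successors⁻ (elements p) w z∈
  ... | x′ , x′∈w , eq with bump-just {p = p} eq
  ...   | bumps z∈p x′<z _ = least z∈p (<-trans (All.lookup x< x′∈w) x′<z)

minimum-∈ : (u : Row n) → min u ∈ supp u
minimum-∈ (row p ne) = go p ne
  where
  go : ∀ {n} (p : Subset n) .(ne : Nonempty p) → minimum p ne ∈ p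
  go []            ne = ⊥-elim-irr (∉[] ne)
    where
    ∉[] : ¬ Nonempty []
    ∉[] (() , _)
  go (inside  ∷ p) ne = here
  go (outside ∷ p) ne = there (go p _)

minimum-≤ : (u : Row n) → x ∈ supp u → min u ≤ x
minimum-≤ (row p ne) = go p ne
  where
  go : ∀ {n} (p : Subset n) .(ne : Nonempty p) {x} → x ∈ p → minimum p ne ≤ x
  go (inside  ∷ p) ne _           = z≤n
  go (outside ∷ p) ne (there x∈p) = s≤s (go p _ x∈p)

-- t is the top row and b the bottom row of N(uv).
data NShape (u v : Row n) : List (Row n) → Set where
  one : ∀ b → NShape u v (b ∷ [])
  two : ∀ t b →
        (∀ {y} → y ∈ supp t → ∃ λ x → x ∈ supp v × Bump x (supp u) (just y)) →
        (∀ {x y} → x ∈ supp v → Bump x (supp u) (just y) → y ∈ supp t) →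
        supp b ≡ supp u ∪ supp v → NShape u v (t ∷ b ∷ [])

out-letters : ∀ (u v : Row n) →
              out ⊥ (letters u ++ letters v) ≡ successors (letters u) (letters v)
out-letters u v
  rewrite out-++ ⊥ (letters u) (letters v)
        | out-⊥-increasing (Sorted⇒≤ (elements-sorted (supp u)))
        | absorb-elements ⊥ (supp u) | ∪-identityˡ (supp u) =
  out-sorted (supp u) (elements-sorted (supp v))

absorb-letters : ∀ (u v : Row n) → absorb ⊥ (letters u ++ letters v) ≡ supp u ∪ supp v
absorb-letters u v
  rewrite absorb-++ ⊥ (letters u) (letters v)
        | absorb-elements ⊥ (supp u) | ∪-identityˡ (supp u) = absorb-elements (supp u) (supp v)

-- The letters bumped from the bottom row form a weakly increasing word, so inserting them above
-- bumps nothing and no third row appears.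
𝓡N-shape : ∀ (u v : Row n) → NShape u v (𝓡N u v)
𝓡N-shape {n} u v with N-nonempty (letters u ++ letters v) (∈-++⁺ˡ (∈-elements⁺ (minimum-∈ u)))
... | b , supp-b , eq rewrite eq | out-letters u v = top ys ≡.refl
  where
  ys : List (Fin n)
  ys = successors (letters u) (letters v)

  top : ∀ w → ys ≡ w → NShape u v (reverse (b ∷ N w))
  top []      _ = one b
  top (y ∷ w) w≡ with N-∷ y w
  ... | t , supp-t , eq′
    rewrite eq′ | out-⊥-increasing (subst (AllPairs _≤_) w≡
                    (successors-increasing (supp u) (elements-sorted (supp v)))) =
    two t b sound complete (≡.trans supp-b (absorb-letters u v))
    where
    sound : ∀ {y} → y ∈ supp t → ∃ λ x → x ∈ supp v × Bump x (supp u) (just y)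
    sound y∈t with ∈-absorb⁻ ⊥ (y ∷ w) (subst (_ ∈_) supp-t y∈t)
    ... | inj₁ y∈⊥ = contradiction y∈⊥ ∉⊥
    ... | inj₂ y∈w with ∈-successors⁻ (letters u) (letters v) (subst (_ ∈ˡ_) (≡.sym w≡) y∈w)
    ...   | x , x∈v , eq = x , ∈-elements⁻ x∈v , bump-just {p = supp u} eq

    complete : ∀ {x y} → x ∈ supp v → Bump x (supp u) (just y) → y ∈ supp t
    complete x∈v B = subst (_ ∈_) (≡.sym supp-t)
      (∈-absorbʳ ⊥ (subst (_ ∈ˡ_) w≡ (∈-successors⁺ (letters u) (∈-elements⁺ x∈v) (bump≡ B))))

-- Termination

-- Complements to `n`, so that raising a minimum or enlarging a row lowers the digit. Both are at
-- most `n`, hence digits in base `n + 1`.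
minDigit sizeDigit : Row n → ℕ
minDigit  {n = n} u = n ∸ toℕ (min u)
sizeDigit {n = n} u = n ∸ ∣ supp u ∣

minDigit< : ∀ (u : Row n) → minDigit u ℕ.< suc n
minDigit< {n = n} u = s≤s (ℕ.m∸n≤m n (toℕ (min u)))

sizeDigit< : ∀ (u : Row n) → sizeDigit u ℕ.< suc n
sizeDigit< {n = n} u = s≤s (ℕ.m∸n≤m n ∣ supp u ∣)

minCode : List (Row n) → ℕ
minCode         []      = 0
minCode {n = n} (u ∷ w) = minDigit u * suc n ^ length w + minCode w

sizeCode : List (Row n) → ℕ
sizeCode         []      = 0
sizeCode {n = n} (u ∷ w) = sizeDigit u + suc n * sizeCode w

infix 4 _≺_

-- A reduction u v ⇒ t b of length two either raises the minimum of the left row,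
-- or fixes both minima and enlarges the right row.  Hence, for words of a given
-- length, the minima are compared lexicographically from the left, and then the
-- sizes from the right; both codes are the corresponding numerals in base n + 1.
_≺_ : List (Row n) → List (Row n) → Set
_≺_ = ×-Lex _≡_ ℕ._<_ (×-Lex _≡_ ℕ._<_ ℕ._<_) on (λ w → length w , minCode w , sizeCode w)

≺-wellFounded : WellFounded (_≺_ {n})
≺-wellFounded = On.wellFounded _
  (×-wellFounded ℕ.<-wellFounded (×-wellFounded ℕ.<-wellFounded ℕ.<-wellFounded))

≺-∷ : ∀ (u : Row n) w w′ → w ≺ w′ → u ∷ w ≺ u ∷ w′
≺-∷ u w w′ (inj₁ shorter) = inj₁ (s≤s shorter)
≺-∷ {n = n} u w w′ (inj₂ (len , inj₁ lt)) = inj₂ (≡.cong suc len , inj₁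
  (subst (λ k → minDigit u * suc n ^ k + minCode w ℕ.<
                minDigit u * suc n ^ length w′ + minCode w′)
         (≡.sym len) (ℕ.+-monoʳ-< _ lt)))
≺-∷ {n = n} u w w′ (inj₂ (len , inj₂ (eq , lt))) = inj₂ (≡.cong suc len , inj₂
  (≡.cong₂ (λ k m → minDigit u * suc n ^ k + m) len eq ,
   ℕ.+-monoʳ-< (sizeDigit u) (ℕ.*-monoʳ-< (suc n) lt)))

≺-++ : ∀ (l w w′ : List (Row n)) → w ≺ w′ → l ++ w ≺ l ++ w′
≺-++ []      w w′ A = A
≺-++ (u ∷ l) w w′ A = ≺-∷ u (l ++ w) (l ++ w′) (≺-++ l w w′ A)

-- Lowering the leading digit frees at least a full `b`, which the next digit cannot make up since
-- `c′ < b`; `k` is the place value of that digit and `r` the common tail.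
numeral-< : ∀ {a a′ c c′} b k r → .⦃ _ : NonZero k ⦄ → a′ ℕ.< a → c′ ℕ.< b →
            a′ * (b * k) + (c′ * k + r) ℕ.< a * (b * k) + (c * k + r)
numeral-< {a} {a′} {c} {c′} b k r a′<a c′<b = begin-strict
  a′ * (b * k) + (c′ * k + r)  ≡⟨ regroup a′ b c′ k r ⟩
  (a′ * b + c′) * k + r        <⟨ ℕ.+-monoˡ-< r (ℕ.*-monoˡ-< k leading) ⟩
  (a * b + c) * k + r          ≡⟨ ≡.sym (regroup a b c k r) ⟩
  a * (b * k) + (c * k + r)    ∎
  where
  open ℕ.≤-Reasoning
  regroup : ∀ a b c k r → a * (b * k) + (c * k + r) ≡ (a * b + c) * k + r
  regroup = solve-∀
  leading : a′ * b + c′ ℕ.< a * b + c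
  leading = begin-strict
    a′ * b + c′  <⟨ ℕ.+-monoʳ-< (a′ * b) c′<b ⟩
    a′ * b + b   ≡⟨ ℕ.+-comm (a′ * b) b ⟩
    suc a′ * b   ≤⟨ ℕ.*-monoˡ-≤ b a′<a ⟩
    a * b        ≤⟨ ℕ.m≤m+n (a * b) c ⟩
    a * b + c    ∎

digit-< : ∀ {c c′ y y′} b → c′ ℕ.< b → y′ ℕ.< y → c′ + b * y′ ℕ.< c + b * y
digit-< {c} {c′} {y} {y′} b c′<b y′<y = begin-strict
  c′ + b * y′  <⟨ ℕ.+-monoˡ-< (b * y′) c′<b ⟩
  b + b * y′   ≡⟨ ≡.sym (ℕ.*-suc b y′) ⟩
  b * suc y′   ≤⟨ ℕ.*-monoʳ-≤ b y′<y ⟩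
  b * y        ≤⟨ ℕ.m≤n+m (b * y) c ⟩
  c + b * y    ∎
  where open ℕ.≤-Reasoning

NShape-≺ : ∀ {u v : Row n} {z} → .(u ⋪ v) → NShape u v z → ∀ w → z ++ w ≺ u ∷ v ∷ w
NShape-≺ u⋪v (one b) w = inj₁ ℕ.≤-refl
NShape-≺ {n = n} {u = u} {v = v} u⋪v (two t b sound complete supp-b) w with min v <? min u
-- Every letter of `t` is bumped by a smaller letter of `v`, hence exceeds `min v`, which is at
-- least `min u`.
... | no min-v≮min-u = inj₂ (≡.refl , inj₁ (numeral-< {c = minDigit v} {c′ = minDigit b}
  (suc n) (suc n ^ length w) (minCode w) ⦃ ℕ.m^n≢0 (suc n) (length w) ⦄
  (ℕ.∸-monoʳ-< raised (ℕ.<⇒≤ (toℕ<n (min t)))) (minDigit< b)))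
  where
  raised : min u < min t
  raised with sound (minimum-∈ t)
  ... | x , x∈v , bumps _ x<t _ =
    ℕ.≤-<-trans (ℕ.≮⇒≥ min-v≮min-u) (ℕ.≤-<-trans (minimum-≤ v x∈v) x<t)
-- Here `min v` bumps `min u`, so `t` keeps the minimum of `u`, and `b` that of `v`. As `u ⋪ v`,
-- some letter of `u` is missing from `v`, so `b` is strictly larger than `v`.
... | yes min-v<min-u = inj₂ (≡.refl , inj₂ (mins ,
  digit-< {c = sizeDigit u} {c′ = sizeDigit t} (suc n) (sizeDigit< t)
    (ℕ.+-monoˡ-< (suc n * sizeCode w) {sizeDigit b} {sizeDigit v}
      (ℕ.∸-monoʳ-< (p⊂q⇒∣p∣<∣q∣ enlarged) (∣p∣≤n (supp b))))))
  where
  min-t : min t ≡ min u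
  min-t with sound (minimum-∈ t)
  ... | _ , _ , bumps t∈u _ _ = ≤-antisym
    (minimum-≤ t (complete (minimum-∈ v)
      (bumps (minimum-∈ u) min-v<min-u λ z∈u _ → minimum-≤ u z∈u)))
    (minimum-≤ u t∈u)
  min-b : min b ≡ min v
  min-b = ≤-antisym
    (minimum-≤ b (subst (_ ∈_) (≡.sym supp-b) (x∈p∪q⁺ (inj₂ (minimum-∈ v)))))
    ([ (λ ∈u → ≤-trans (<⇒≤ min-v<min-u) (minimum-≤ u ∈u)) , minimum-≤ v ]′
      (x∈p∪q⁻ (supp u) (supp v) (subst (_ ∈_) supp-b (minimum-∈ b))))
  mins : minCode (t ∷ b ∷ w) ≡ minCode (u ∷ v ∷ w)
  mins rewrite min-t | min-b = ≡.refl
  enlarged : supp v ⊂ supp b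
  enlarged with any? (λ x → (x ∈? supp u) ×-dec ¬? (x ∈? supp v))
  ... | yes (x , x∈u , x∉v) rewrite supp-b =
    q⊆p∪q (supp u) (supp v) , x , x∈p∪q⁺ (inj₁ x∈u) , x∉v
  ... | no  none = ⊥-elim-irr (u⋪v
    ((λ {x} x∈u → decidable-stable (x ∈? supp v) λ x∉v → none (x , x∈u , x∉v)) , min-v<min-u))


-- Reduction steps: termination and compatibility with both congruences

module _ {n : ℕ} where

  open 2-Polygraph (Σrow n)

  ⟶⇒≺ : ∀ {w w′} → w ⟶ w′ → w′ ≺ w
  ⟶⇒≺ (whisker l (α u v u⋪v) r) =
    ≺-++ l (𝓡N u v ++ r) (u ∷ v ∷ r) (NShape-≺ u⋪v (𝓡N-shape u v) r)

  terminating : StronglyNormalizing _⟶_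
  terminating = Subrelation.wellFounded ⟶⇒≺ ≺-wellFounded

  ⟶⇒~ : ∀ {w w′} → w ⟶ w′ → flatten w ~ flatten w′
  ⟶⇒~ (whisker l (α u v _) r)
    rewrite concatMap-++ letters l (u ∷ v ∷ r) | concatMap-++ letters l (𝓡N u v ++ r)
          | concatMap-++ letters (𝓡N u v) r
          | ≡.sym (++-assoc (letters u) (letters v) (flatten r)) =
    ~-++ˡ (flatten l) (~-++ʳ (flatten r) (sym (𝓡N-~ u v)))

  ↠⇒~ : ∀ {w w′} → Star _⟶_ w w′ → flatten w ~ flatten w′
  ↠⇒~ ε        = refl
  ↠⇒~ (s ◅ ss) = trans (⟶⇒~ s) (↠⇒~ ss)

  ⟶⇒≈ : ∀ {w w′} → w ⟶ w′ → Congruence Relator w w′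
  ⟶⇒≈ (whisker l β r) = cong (refl {u = l}) (cong (gen (relator β)) (refl {u = r}))

  ↠⇒≈ : ∀ {w w′} → Star _⟶_ w w′ → Congruence Relator w w′
  ↠⇒≈ ε        = refl
  ↠⇒≈ (s ◅ ss) = trans (⟶⇒≈ s) (↠⇒≈ ss)

  path-linked : ∀ {w ŵ : Word} → LeftmostPath w ŵ → Linked _◁_ ŵ
  path-linked (done lnk) = lnk
  path-linked (_ ∷ p)    = path-linked p

-- Readings separate tableaux

Linked-init : ∀ W {u : Row n} → Linked _◁_ (W ++ [ u ]) → Linked _◁_ W
Linked-init []          _         = []
Linked-init (_ ∷ [])    _         = [-]
Linked-init (_ ∷ _ ∷ W) (r ∷ lnk) = r ∷ Linked-init (_ ∷ W) lnk

Linked-last : ∀ W {u v : Row n} → Linked _◁_ ((W ++ [ v ]) ++ [ u ]) → v ◁ u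
Linked-last []          (r ∷ _)   = r
Linked-last (_ ∷ [])    (_ ∷ lnk) = Linked-last [] lnk
Linked-last (_ ∷ x ∷ W) (_ ∷ lnk) = Linked-last (x ∷ W) lnk

-- Since `min u` lies below all of `v` and `u` contains `v`, each letter of `v` is the successor in
-- `v` of some letter of `u`; the output is `v` with repetitions.
out-◁ : ∀ {u v : Row n} → v ◁ u → out (supp v) (letters u) ~ letters v
out-◁ {u = u} {v = v} (v⊆u , min-u<min-v)
  rewrite out-sorted (supp v) (elements-sorted (supp u)) =
  go (elements-sorted (supp u)) (∈-elements⁺ (minimum-∈ u))
     (λ x∈v → ℕ.<-≤-trans min-u<min-v (minimum-≤ v (∈-elements⁻ x∈v)))
     -- Both words are filters of `allFin`, so inclusion of supports yields a sublist.
     (filter⁺ (_∈? supp v) (_∈? supp u) (λ { ≡.refl → v⊆u }) (⊑-refl {x = allFin _}))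
  where
  go : ∀ {us vs : List (Fin _)} {a} → Sorted us → a ∈ˡ us → (∀ {x} → x ∈ˡ vs → a < x) →
       vs ⊑ us → successors vs us ~ vs
  go us<         _              _   (_ ∷ʳ vs⊑us)    = successors-⊑ us< vs⊑us
  go (u< ∷ us<)  (here ≡.refl)  a<  (≡.refl ∷ _)    =
    contradiction (a< (here ≡.refl)) (<-irrefl ≡.refl)
  go (u< ∷ us<)  (there a∈us)   a<  (≡.refl ∷ _)    =
    contradiction (<-trans (a< (here ≡.refl)) (All.lookup u< a∈us)) (<-irrefl ≡.refl)

-- Each row contains the row above it, so the union of all rows is the bottom one.
absorb-flatten : ∀ {W} (u : Row n) → Reverse W → Linked _◁_ (W ++ [ u ]) →
                 absorb ⊥ (flatten (W ++ [ u ])) ≡ supp u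
absorb-flatten u [] _
  rewrite flatten-∷ʳ [] u | absorb-elements ⊥ (supp u) = ∪-identityˡ (supp u)
absorb-flatten u (W ∶ R ∶ʳ v) lnk
  rewrite flatten-∷ʳ (W ++ [ v ]) u | absorb-++ ⊥ (flatten (W ++ [ v ])) (letters u)
        | absorb-flatten v R (Linked-init (W ++ [ v ]) lnk) | absorb-elements (supp v) (supp u) =
  ⊆-antisym (λ x∈ → [ proj₁ (Linked-last W lnk) , (λ x∈u → x∈u) ]′ (x∈p∪q⁻ (supp v) (supp u) x∈))
            (q⊆p∪q (supp v) (supp u))

-- By induction, reading down to `v` leaves the state `supp v` and emits the rows above `v`, up to
-- equivalence; by `out-◁` the letters of `u` then push out `v`.
out-flatten : ∀ {W} (u : Row n) → Reverse W → Linked _◁_ (W ++ [ u ]) →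
              out ⊥ (flatten (W ++ [ u ])) ~ flatten W
out-flatten u [] _
  rewrite flatten-∷ʳ [] u = ~-reflexive (out-⊥-increasing (Sorted⇒≤ (elements-sorted (supp u))))
out-flatten u (W ∶ R ∶ʳ v) lnk
  rewrite flatten-∷ʳ (W ++ [ v ]) u | out-++ ⊥ (flatten (W ++ [ v ])) (letters u)
        | absorb-flatten v R (Linked-init (W ++ [ v ]) lnk) =
  trans (cong (out-flatten v R (Linked-init (W ++ [ v ]) lnk)) (out-◁ (Linked-last W lnk)))
        (~-reflexive (≡.sym (flatten-∷ʳ W v)))

Row-≡ : ∀ {u v : Row n} → supp u ≡ supp v → u ≡ v
Row-≡ ≡.refl = ≡.refl

-- From the class of the reading of a tableau, `absorb-cong` recovers the bottom
-- row, and `out-cong` the class of the reading of the rows above it.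
flatten-injective : ∀ {W W′ : List (Row n)} → Linked _◁_ W → Linked _◁_ W′ →
                    flatten W ~ flatten W′ → W ≡ W′
flatten-injective {n} lnk lnk′ = go (reverseView _) (reverseView _) lnk lnk′
  where
  ⊥≢supp : ∀ (u : Row n) {p} → p ≡ supp u → ⊥ ≡ p → {A : Set} → A
  ⊥≢supp u ≡.refl eq = contradiction (subst (min u ∈_) (≡.sym eq) (minimum-∈ u)) ∉⊥

  go : ∀ {W W′ : List (Row n)} → Reverse W → Reverse W′ → Linked _◁_ W → Linked _◁_ W′ →
       flatten W ~ flatten W′ → W ≡ W′
  go []           []              _   _    _ = ≡.refl
  go []           (W′ ∶ R′ ∶ʳ u′) _   lnk′ A =
    ⊥≢supp u′ (absorb-flatten u′ R′ lnk′) (absorb-cong A ⊥)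
  go (W ∶ R ∶ʳ u) []              lnk _    A =
    ⊥≢supp u (absorb-flatten u R lnk) (absorb-cong (sym A) ⊥)
  go (W ∶ R ∶ʳ u) (W′ ∶ R′ ∶ʳ u′) lnk lnk′ A = ≡.cong₂ (λ W (u : Row n) → W ++ [ u ])
    (go R R′ (Linked-init W lnk) (Linked-init W′ lnk′)
      (trans (sym (out-flatten u R lnk)) (trans (out-cong A ⊥) (out-flatten u′ R′ lnk′))))
    (Row-≡ (≡.trans (≡.sym (absorb-flatten u R lnk))
           (≡.trans (absorb-cong A ⊥) (absorb-flatten u′ R′ lnk′))))

-- Confluence and the isomorphism with the stylic monoid

module _ {n : ℕ} where

  open 2-Polygraph (Σrow n)

  normalForm : ∀ (w : Word) → ∃ (LeftmostPath w)
  normalForm w = leftmostPath w (terminating w)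

  convergent : Convergent
  convergent = record { terminating = terminating ; confluent = confluent }
    where
    confluent : Confluent _⟶_
    -- Both normal forms flatten into the stylic class of the common source, and that class
    -- determines an irreducible word.
    confluent {_} {v} {w} u↠v u↠w with normalForm v | normalForm w
    ... | v̂ , p | ŵ , q = v̂ , path⇒↠ p , subst (Star _⟶_ w) (≡.sym v̂≡ŵ) (path⇒↠ q)
      where
      v̂≡ŵ : v̂ ≡ ŵ
      v̂≡ŵ = flatten-injective (path-linked p) (path-linked q)
        (trans (sym (↠⇒~ (u↠v ◅◅ path⇒↠ p))) (↠⇒~ (u↠w ◅◅ path⇒↠ q)))

  flatten-cong : ∀ {w w′ : Word} → Congruence Relator w w′ → flatten w ~ flatten w′
  flatten-cong (gen (relator (α u v _)))
    rewrite ++-identityʳ (letters v) = sym (𝓡N-~ u v)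
  flatten-cong refl        = refl
  flatten-cong (sym A)     = sym (flatten-cong A)
  flatten-cong (trans A B) = trans (flatten-cong A) (flatten-cong B)
  flatten-cong (cong {u} {u′} {v} {v′} A B)
    rewrite concatMap-++ letters u v | concatMap-++ letters u′ v′ =
    cong (flatten-cong A) (flatten-cong B)

  -- Every word is congruent to its normal form, and `flatten-injective` identifies the two normal
  -- forms.
  flatten-reflects : ∀ {w w′ : Word} → flatten w ~ flatten w′ → Congruence Relator w w′
  flatten-reflects {w} {w′} A with normalForm w | normalForm w′
  ... | ŵ , p | ŵ′ , p′ with flatten-injective (path-linked p) (path-linked p′)
                               (trans (sym (↠⇒~ (path⇒↠ p))) (trans A (↠⇒~ (path⇒↠ p′))))
  ...   | ≡.refl = trans (↠⇒≈ (path⇒↠ p)) (sym (↠⇒≈ (path⇒↠ p′)))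

  flatten-singletons : ∀ (w : List (Fin n)) → flatten (map singleton w) ≡ w
  flatten-singletons []      = ≡.refl
  flatten-singletons (x ∷ w) = ≡.cong₂ _++_ (elements-⁅⁆ x) (flatten-singletons w)

  -- The isomorphism sends the generator of a row to its increasing word; one-letter rows provide
  -- preimages of all words.
  presents : Presents (Σrow n) (Styl n)
  presents = flatten , record
    { isMonoidMonomorphism = record
      { isMonoidHomomorphism = record
        { isMagmaHomomorphism = record
          { isRelHomomorphism = record { cong = flatten-cong }
          ; homo              = λ w w′ → ~-reflexive (concatMap-++ letters w w′)
          }
        ; ε-homo = refl
        }
      ; injective = flatten-reflects
      }
    ; surjective = λ w → map singleton w , λ A →
        trans (flatten-cong A) (~-reflexive (flatten-singletons w))
    }

theorem3p2p6 : (n : ℕ) → n ≥ 1 →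
    Σ[ convergent ∈ 2-Polygraph.Convergent (Σrow n) ]
    IsFiniteCoherentPresentation (Σrowcoh n convergent) (Styl n)
theorem3p2p6 n _ = convergent , record
  { isFinite = record
    { finite₁ = Finite-Row
    ; finite₂ = Finite-ReduciblePair
    ; finite₃ = Finite-ReducibleTriple
    }
  ; isCoherentPresentation = record
    { presents        = presents
    ; isHomotopyBasis = RowCoherence.homotopyBasis n convergent
    }
  }
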